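{- Let $\mathcal{I}$ be a Ramsey finitely homogeneous structure, let $\mathcal{M}$ be a highly saturated model of a theory $T$, and let $m\ge 1$. Then the following are equivalent. (1) There is an $m$-ary trace definition of $\mathcal{I}$ in $\mathcal{M}$. (2) There is a map $I\to M^m$ which is an uncollapsed indiscernible picture of $\mathcal{I}$ in $\mathcal{M}$ over a small set of parameters. Therefore the following are equivalent. (3) $T$ trace defines $\mathcal{I}$. (4) There is an uncollapsed indiscernible picture of $\mathcal{I}$ in $\mathcal{M}$ over a small set of parameters.
   Context: Conventions: structures and theories are first order; theories are complete and consistent; "definable" means definable with parameters. An $m$-ary trace definition of a structure $\mathcal{I}$ in a structure $\mathcal{M}$ is a map $\tau\colon I\to M^m$ such that for every $k\ge 1$ and every $\mathcal{I}$-definable $X\subseteq I^k$ there is an $\mathcal{M}$-definable $Y\subseteq M^{km}$ with $X=\{(a_1,\dots,a_k)\in I^k : (\tau(a_1),\dots,\tau(a_k))\in Y\}$. $T$ trace defines $\mathcal{I}$ if for some $m\ge 1$ there is an $m$-ary trace definition of $\mathcal{I}$ in some model of $T$. "Highly saturated" means $\kappa$-saturated and strongly $\kappa$-homogeneous for a sufficiently large cardinal $\kappa$, and "small" means of cardinality $<\kappa$. A finitely homogeneous structure is a countably infinite structure in a finite relational language such that every isomorphism between finite substructures extends to an automorphism. $\mathrm{Age}(\mathcal{I})$ is the class of finite structures that embed into $\mathcal{I}$. $\mathcal{I}$ is Ramsey if whenever $\mathcal{A},\mathcal{B}\in\mathrm{Age}(\mathcal{I})$ and the embeddings $\mathcal{A}\hookrightarrow\mathcal{I}$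 are colored with finitely many colors, there is an embedding $\iota\colon\mathcal{B}\hookrightarrow\mathcal{I}$ such that all embeddings of $\mathcal{A}$ into the image of $\iota$ have the same color. A picture of $\mathcal{I}$ in $\mathcal{M}$ is a map $\gamma\colon I\to M^m$ for some $m\ge 1$; for $a=(a_1,\dots,a_k)\in I^k$ write $\gamma(a)=(\gamma(a_1),\dots,\gamma(a_k))$. For $A\subseteq M$, $\gamma$ is indiscernible over $A$ if for all $k\ge 1$ and $a,b\in I^k$, $\mathrm{tp}_{\mathcal{I}}(a)=\mathrm{tp}_{\mathcal{I}}(b)$ implies $\mathrm{tp}_{\mathcal{M}}(\gamma(a)|A)=\mathrm{tp}_{\mathcal{M}}(\gamma(b)|A)$; $\gamma$ is uncollapsed over $A$ if for all $k\ge 1$ and $a,b\in I^k$, $\mathrm{tp}_{\mathcal{M}}(\gamma(a)|A)=\mathrm{tp}_{\mathcal{M}}(\gamma(b)|A)$ implies $\mathrm{tp}_{\mathcal{I}}(a)=\mathrm{tp}_{\mathcal{I}}(b)$. -}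

module Defs where

open import Data.Empty.Polymorphic using (⊥)
open import Data.Fin.Base using (Fin)
open import Data.List.Base using (List)
import Data.List.Relation.Unary.All as List
open import Data.Nat.Base using (ℕ; suc; _+_; _*_; NonZero)
open import Data.Product.Base using (Σ; ∃; ∃₂; _×_; _,_; proj₁; proj₂)
open import Data.Sum.Base using (_⊎_)
open import Data.Vec.Base using (Vec; []; _∷_; [_]; _++_; map; concat; lookup)
open import Data.Vec.Relation.Unary.All as All using (All)
open import Data.Vec.Relation.Unary.All.Properties using (map⁺)
open import Function.Bundles using (Injection; _↔_; _⇔_)
open import Function.Definitions using (Injective; Surjective)
open import Level using (Level; _⊔_) renaming (suc to lsuc)
open import Relation.Binary.Bundles using (Setoid)
import Relation.Binary.Construct.On as On
open import Relation.Binary.PropositionalEquality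
  using (_≡_; _≗_; setoid)
open import Relation.Nullary.Negation.Core using (¬_)
open import Relation.Unary using (Pred; _∈_; _≐_; ∅; U; Irrelevant)

private
  variable
    ℓ a b p q : Level
    n k : ℕ

------------------------------------------------------------------------
-- Syntax.  A formula with n free variables is indexed by n; quantifiers
-- bind de Bruijn variable zero.

record Language (ℓ : Level) : Set (lsuc ℓ) where
  field
    Fun      : Set ℓ
    funArity : Fun → ℕ
    Rel      : Set ℓ
    relArity : Rel → ℕ

open Language public

data Term (L : Language ℓ) (n : ℕ) : Set ℓ where
  var : Fin n → Term L n
  app : (f : Fun L) → Vec (Term L n) (funArity L f) → Term L n

infix  8 _≈ᶠ_
infixr 7 _∧ᶠ_
infixr 6 _∨ᶠ_
infixr 5 _⇒ᶠ_

data Formula (L : Language ℓ) (n : ℕ) : Set ℓ where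
  ⊥ᶠ   : Formula L n
  _≈ᶠ_ : Term L n → Term L n → Formula L n
  relᶠ : (R : Rel L) → Vec (Term L n) (relArity L R) → Formula L n
  _∧ᶠ_ : Formula L n → Formula L n → Formula L n
  _∨ᶠ_ : Formula L n → Formula L n → Formula L n
  _⇒ᶠ_ : Formula L n → Formula L n → Formula L n
  ∀ᶠ_  : Formula L (suc n) → Formula L n
  ∃ᶠ_  : Formula L (suc n) → Formula L n

¬ᶠ_ : {L : Language ℓ} → Formula L n → Formula L n
¬ᶠ φ = φ ⇒ᶠ ⊥ᶠ

Sentence : Language ℓ → Set ℓ
Sentence L = Formula L 0

------------------------------------------------------------------------
-- Structures (with nonempty universe) and satisfaction

record Structure (L : Language ℓ) : Set (lsuc ℓ) where
  field
    Carrier  : Set ℓ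
    nonempty : Carrier
    funⁱ     : (f : Fun L) → Vec Carrier (funArity L f) → Carrier
    relⁱ     : (R : Rel L) → Pred (Vec Carrier (relArity L R)) ℓ

open Structure public

module _ {L : Language ℓ} (M : Structure L) where

  eval  : Vec (Carrier M) n → Term L n → Carrier M
  evals : Vec (Carrier M) n → Vec (Term L n) k → Vec (Carrier M) k
  eval ρ (var i)    = lookup ρ i
  eval ρ (app f ts) = funⁱ M f (evals ρ ts)
  evals ρ []        = []
  evals ρ (t ∷ ts)  = eval ρ t ∷ evals ρ ts

infix 4 _⊨_[_]

_⊨_[_] : {L : Language ℓ} (M : Structure L) →
         Formula L n → Vec (Carrier M) n → Set ℓ
M ⊨ ⊥ᶠ        [ ρ ] = ⊥
M ⊨ s ≈ᶠ t    [ ρ ] = eval M ρ s ≡ eval M ρ t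
M ⊨ relᶠ R ts [ ρ ] = relⁱ M R (evals M ρ ts)
M ⊨ φ ∧ᶠ ψ    [ ρ ] = (M ⊨ φ [ ρ ]) × (M ⊨ ψ [ ρ ])
M ⊨ φ ∨ᶠ ψ    [ ρ ] = (M ⊨ φ [ ρ ]) ⊎ (M ⊨ ψ [ ρ ])
M ⊨ φ ⇒ᶠ ψ    [ ρ ] = (M ⊨ φ [ ρ ]) → (M ⊨ ψ [ ρ ])
M ⊨ ∀ᶠ φ      [ ρ ] = ∀ x → M ⊨ φ [ x ∷ ρ ]
M ⊨ ∃ᶠ φ      [ ρ ] = ∃ λ x → M ⊨ φ [ x ∷ ρ ]

------------------------------------------------------------------------
-- Theories

Theory : Language ℓ → Set (lsuc ℓ)
Theory {ℓ} L = Pred (Sentence L) ℓ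

module _ {L : Language ℓ} where

  IsModel : Theory L → Structure L → Set ℓ
  IsModel T M = ∀ φ → φ ∈ T → M ⊨ φ [ [] ]

  Entails : Theory L → Sentence L → Set (lsuc ℓ)
  Entails T φ = ∀ M → IsModel T M → M ⊨ φ [ [] ]

  Consistent : Theory L → Set (lsuc ℓ)
  Consistent T = ∃ λ M → IsModel T M

  Complete : Theory L → Set (lsuc ℓ)
  Complete T = ∀ φ → Entails T φ ⊎ Entails T (¬ᶠ φ)

------------------------------------------------------------------------
-- Definability with parameters, and types

record FormulaOver {L : Language ℓ} (M : Structure L)
                   (A : Pred (Carrier M) a) (k : ℕ) : Set (ℓ ⊔ a) where
  field
    {numParams} : ℕ
    formula     : Formula L (k + numParams)
    params      : Vec (Carrier M) numParams
    params∈A    : All A params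

module _ {L : Language ℓ} (M : Structure L) where

  Solutions : {A : Pred (Carrier M) a} →
              FormulaOver M A k → Pred (Vec (Carrier M) k) ℓ
  Solutions φ xs = M ⊨ formula [ xs ++ params ]
    where open FormulaOver φ

  Definable : Pred (Vec (Carrier M) k) ℓ → Set ℓ
  Definable {k} X = ∃ λ (φ : FormulaOver M U k) → X ≐ Solutions φ

  -- Types are sets of formulas, so they are compared with _≐_.
  tp : (A : Pred (Carrier M) a) → Vec (Carrier M) k →
       Pred (FormulaOver M A k) ℓ
  tp A xs φ = xs ∈ Solutions φ

------------------------------------------------------------------------
-- Cardinalities.  A cardinal κ is represented by any type K of size κ,
-- and S ≺ T says that S has strictly smaller cardinality than T.

infix 4 _≺_

_≺_ : Setoid a p → Setoid b q → Set (a ⊔ p ⊔ b ⊔ q)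
S ≺ T = Injection S T × ¬ Injection T S

-- The elements of a subset are compared as elements of C, so that a
-- subset never has more elements because membership has several proofs.
subset : {C : Set a} → Pred C p → Setoid (a ⊔ p) a
subset {C = C} A = On.setoid (setoid C) (proj₁ {B = A})

Small : {C : Set a} → Set b → Pred C p → Set (a ⊔ b ⊔ p)
Small K A = subset A ≺ setoid K

Finite : Set a → Set a
Finite C = ∃ λ n → C ↔ Fin n

------------------------------------------------------------------------
-- Embeddings and substructures

record Embedding {L : Language ℓ} (A B : Structure L) : Set ℓ where
  field
    to        : Carrier A → Carrier B
    injective : Injective _≡_ _≡_ to
    fun-pres  : ∀ f xs → to (funⁱ A f xs) ≡ funⁱ B f (map to xs)
    rel-pres  : ∀ R xs → relⁱ A R xs ⇔ relⁱ B R (map to xs)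

record Isomorphism {L : Language ℓ} (A B : Structure L) : Set ℓ where
  field
    embedding : Embedding A B
  open Embedding embedding public
  field
    surjective : Surjective _≡_ _≡_ to

Automorphism : {L : Language ℓ} → Structure L → Set ℓ
Automorphism M = Isomorphism M M

-- Irrelevance of membership ensures that two elements of the induced
-- structure are equal exactly when they are equal in M.
record Substructure {L : Language ℓ} (M : Structure L) : Set (lsuc ℓ) where
  field
    domain     : Pred (Carrier M) ℓ
    irrelevant : Irrelevant domain
    inhabited  : ∃ domain
    closed     : ∀ f {xs} → All domain xs → funⁱ M f xs ∈ domain

  structure : Structure L
  structure = record
    { Carrier  = ∃ domain
    ; nonempty = inhabited
    ; funⁱ     = λ f xs → funⁱ M f (map proj₁ xs) ,
                          closed f (map⁺ (All.universal proj₂ xs))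
    ; relⁱ     = λ R xs → relⁱ M R (map proj₁ xs)
    }

------------------------------------------------------------------------
-- Highly saturated structures

module _ {L : Language ℓ} (K : Set ℓ) (M : Structure L) where

  FinitelySatisfiable : {A : Pred (Carrier M) a} →
                        Pred (FormulaOver M A 1) ℓ → Set (ℓ ⊔ a)
  FinitelySatisfiable p = ∀ Δ → List.All (_∈ p) Δ →
    ∃ λ x → List.All (λ φ → [ x ] ∈ Solutions M φ) Δ

  Saturated : Set (lsuc ℓ)
  Saturated = (A : Pred (Carrier M) ℓ) → Small K A →
    (p : Pred (FormulaOver M A 1) ℓ) → FinitelySatisfiable p →
    ∃ λ x → ∀ φ → φ ∈ p → [ x ] ∈ Solutions M φ

  -- f represents the partial map given by its restriction to A; its
  -- values outside A play no role.
  PartialElementary : Pred (Carrier M) ℓ → (Carrier M → Carrier M) → Set ℓ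
  PartialElementary A f = ∀ {n} (φ : Formula L n) xs → All A xs →
    (M ⊨ φ [ xs ]) ⇔ (M ⊨ φ [ map f xs ])

  StronglyHomogeneous : Set (lsuc ℓ)
  StronglyHomogeneous = (A : Pred (Carrier M) ℓ) → Small K A →
    (f : Carrier M → Carrier M) → PartialElementary A f →
    ∃ λ (σ : Automorphism M) → ∀ x → x ∈ A → Isomorphism.to σ x ≡ f x

  -- "Sufficiently large" means κ > |L| + ℵ₀.
  HighlySaturated : Set (lsuc ℓ)
  HighlySaturated =
    (setoid (Fun L ⊎ Rel L ⊎ ℕ) ≺ setoid K) ×
    Saturated ×
    StronglyHomogeneous

------------------------------------------------------------------------
-- Finitely homogeneous and Ramsey structures

record FinitelyHomogeneous {L : Language ℓ} (I : Structure L) :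
                           Set (lsuc ℓ) where
  field
    relational        : ¬ Fun L
    finiteLanguage    : Finite (Rel L)
    countablyInfinite : Carrier I ↔ ℕ
    homogeneous       : (A B : Substructure I) →
      let module A = Substructure A
          module B = Substructure B in
      Finite (∃ A.domain) → Finite (∃ B.domain) →
      (f : Isomorphism A.structure B.structure) →
      ∃ λ (σ : Automorphism I) →
        ∀ x → Isomorphism.to σ (proj₁ x) ≡ proj₁ (Isomorphism.to f x)

module _ {L : Language ℓ} where

  Age : Structure L → Pred (Structure L) ℓ
  Age I A = Finite (Carrier A) × Embedding A I

  _RangesIn_ : {A B I : Structure L} → Embedding A I → Embedding B I → Set ℓ
  e RangesIn ι = ∀ x → ∃ λ y → Embedding.to e x ≡ Embedding.to ι y

  -- A colouring may depend only on the underlying map of an embedding,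
  -- not on the proofs that it is one.
  Ramsey : Structure L → Set (lsuc ℓ)
  Ramsey I = ∀ A B → A ∈ Age I → B ∈ Age I →
    ∀ c (χ : Embedding A I → Fin c) →
    (∀ e e′ → Embedding.to e ≗ Embedding.to e′ → χ e ≡ χ e′) →
    ∃ λ (ι : Embedding B I) →
      ∀ e e′ → e RangesIn ι → e′ RangesIn ι → χ e ≡ χ e′

------------------------------------------------------------------------
-- Trace definitions and pictures

module _ {L₀ L : Language ℓ} (I : Structure L₀) (M : Structure L)
         {m : ℕ} where

  IsTraceDefinition : (Carrier I → Vec (Carrier M) m) → Set (lsuc ℓ)
  IsTraceDefinition τ = ∀ k .{{_ : NonZero k}} (X : Pred (Vec (Carrier I) k) ℓ) →
    Definable I X →
    ∃ λ (Y : Pred (Vec (Carrier M) (k * m)) ℓ) →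
      Definable M Y × (X ≐ λ xs → concat (map τ xs) ∈ Y)

  module _ (A : Pred (Carrier M) ℓ) (γ : Carrier I → Vec (Carrier M) m) where

    Indiscernible : Set ℓ
    Indiscernible = ∀ k .{{_ : NonZero k}} (xs ys : Vec (Carrier I) k) →
      tp I ∅ xs ≐ tp I ∅ ys →
      tp M A (concat (map γ xs)) ≐ tp M A (concat (map γ ys))

    Uncollapsed : Set ℓ
    Uncollapsed = ∀ k .{{_ : NonZero k}} (xs ys : Vec (Carrier I) k) →
      tp M A (concat (map γ xs)) ≐ tp M A (concat (map γ ys)) →
      tp I ∅ xs ≐ tp I ∅ ys

module _ {L₀ L : Language ℓ} (I : Structure L₀) where

  HasTraceDefinition : Structure L → ℕ → Set (lsuc ℓ)
  HasTraceDefinition M m =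
    ∃ λ (τ : Carrier I → Vec (Carrier M) m) → IsTraceDefinition I M τ

  TraceDefines : Theory L → Set (lsuc ℓ)
  TraceDefines T = ∃₂ λ (M : Structure L) m →
    IsModel T M × NonZero m × HasTraceDefinition M m

  HasSmallPicture : Set ℓ → Structure L → ℕ → Set (lsuc ℓ)
  HasSmallPicture K M m =
    ∃ λ (γ : Carrier I → Vec (Carrier M) m) →
    ∃ λ (A : Pred (Carrier M) ℓ) →
      Small K A × Indiscernible I M A γ × Uncollapsed I M A γ

{-# OPTIONS --safe #-}
module Submission where

open import Axiom.ExcludedMiddle using (ExcludedMiddle)
open import Data.Bool.Properties using (T-irrelevant)
open import Data.Empty using (⊥)
open import Data.Empty.Polymorphic using () renaming (⊥-elim to ⊥-elimₚ)
open import Data.Fin.Base as Fin using (Fin; _↑ˡ_; _↑ʳ_)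
open import Data.Fin.Properties
  using (punchIn-punchOut; toℕ-injective; toℕ<n; fromℕ<-toℕ; ℕ→Fin-notInjective)
  renaming (_≟_ to _≟ᶠ_)
open import Data.List.Base as List using (List; []; _∷_)
open import Data.List.Membership.Propositional using (_∈_)
open import Data.List.Membership.Propositional.Properties
  using (∈-concatMap⁺; ∈-++⁺ˡ; ∈-++⁺ʳ; ∈-cartesianProductWith⁺; ∈-allFin; ∈-map⁺)
open import Data.List.Relation.Unary.All as ListAll using ([]; _∷_)
open import Data.List.Relation.Unary.All.Properties using () renaming (++⁺ to ++⁺ₗ; ++⁻ to ++⁻ₗ)
open import Data.List.Relation.Unary.Any as Any using (here; there)
import Data.List.Relation.Unary.Any.Properties as AnyProps
open import Data.Nat.Base as ℕ
  using (ℕ; NonZero; _+_; _*_; _<_; _<′_; ≤′-refl; ≤′-step; _⊔_)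
open import Data.Nat.DivMod using (_%_; [m+kn]%n≡m%n; m<n⇒m%n≡m)
import Data.Nat.Properties as ℕ
open import Data.Product.Base using (Σ; ∃; ∃₂; _×_; _,_; proj₁; proj₂)
open import Data.Product.Function.NonDependent.Propositional using (_×-⇔_)
open import Data.Sum.Base using (_⊎_; inj₁; inj₂)
open import Data.Sum.Function.Propositional using (_⊎-⇔_)
open import Data.Unit.Polymorphic using (⊤)
open import Data.Vec.Base as Vec using (Vec; []; _∷_; _++_; map; lookup; allFin; concat)
open import Data.Vec.Membership.Propositional.Properties using (∈-toList⁺; ∈-lookup)
open import Data.Vec.Properties
open import Data.Vec.Relation.Unary.All as All using (All; []; _∷_)
import Data.Vec.Relation.Unary.All.Properties as AllProps
open import Function.Base using (_∘_)
open import Function.Bundles using (_⇔_; mk⇔; mk⤖; Equivalence; Injection; Inverse)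
open import Function.Construct.Composition using (_⇔-∘_)
open import Function.Construct.Identity using (⇔-id)
open import Function.Construct.Symmetry using (⇔-sym)
open import Function.Properties.Bijection using (⤖⇒↔)
open import Function.Properties.Inverse using (↔-sym; ↔⇒↣)
open import Function.Related.TypeIsomorphisms using (→-cong-⇔)
open import Level using (Level; suc; Lift; lift; lower)
open import Relation.Binary.PropositionalEquality
  using (_≡_; _≢_; refl; sym; trans; cong; cong₂; subst; subst₂; setoid; module ≡-Reasoning)
open import Relation.Nullary.Decidable
  using (Dec; yes; no; True; toWitness; fromWitness; map′; decidable-stable)
open import Relation.Nullary.Negation using (¬_; contradiction)
open import Relation.Unary using (Pred; _≐_; ∅; U)
open import Relation.Unary.Properties using (≐-refl)
open import Defs

-- From a picture γ: by homogeneity the types of k-tuples of I are determined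
-- by finitely many basic formulas, so there are finitely many of them, and
-- γ separates them by formulas over A; a definable set is a Boolean
-- combination of the separating formulas, and its parameters are sent along γ.
--
-- From a trace definition τ in a model N of T: only the traces of the basic
-- formulas matter, which involve finitely many parameters.  Take the
-- parameters as further unknowns and ask for an assignment in M that traces
-- the basic formulas and under which φ(τ xs) and φ(τ ys) are equivalent whenever
-- xs and ys have the same type.  Equivalence for one more pair of a formula φ
-- and a type can be enforced on a finite part of I: the Ramsey property
-- gives an embedding of that part which makes φ constant on the type, and
-- by homogeneity it extends to an automorphism g of I, so that passing to τ ∘ g
-- keeps what was achieved before.  Saturation passes from finite parts to
-- the whole of I, once for every added pair and once more for all pairs.

open Equivalence using (to; from)

private
  variable
    ℓ a : Level
    k n : ℕ

-- Congruence of logical equivalence, and lookups in concatenated vectors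

∀-cong-⇔ : {A : Set ℓ} {P Q : A → Set a} → (∀ x → P x ⇔ Q x) → (∀ x → P x) ⇔ (∀ x → Q x)
∀-cong-⇔ e = mk⇔ (λ f x → to (e x) (f x)) (λ f x → from (e x) (f x))

∃-cong-⇔ : {A : Set ℓ} {P Q : A → Set a} → (∀ x → P x ⇔ Q x) → ∃ P ⇔ ∃ Q
∃-cong-⇔ e = mk⇔ (λ (x , p) → x , to (e x) p) (λ (x , p) → x , from (e x) p)

≡⇒⇔ : {A B : Set ℓ} → A ≡ B → A ⇔ B
≡⇒⇔ refl = ⇔-id _

⇔-cong-⇔ : {A B C D : Set ℓ} → A ⇔ B → C ⇔ D → ((A → C) × (C → A)) ⇔ (B ⇔ D)
⇔-cong-⇔ e f = mk⇔
  (λ (g , h) → mk⇔ (to f ∘ g ∘ from e) (to e ∘ h ∘ from f))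
  (λ g → from f ∘ to g ∘ to e , from e ∘ from g ∘ to f)

map-lookup-map : {A : Set ℓ} {B : Set a} (f : A → B) (xs : Vec A n) (ρ : Vec (Fin n) k) →
                 map (lookup (map f xs)) ρ ≡ map f (map (lookup xs) ρ)
map-lookup-map f xs ρ =
  trans (map-cong (λ i → lookup-map i f xs) ρ) (map-∘ f (lookup xs) ρ)

map-lookup-↑ˡ : {A : Set ℓ} (xs : Vec A k) (ys : Vec A n) →
                map (lookup (xs ++ ys)) (map (_↑ˡ n) (allFin k)) ≡ xs
map-lookup-↑ˡ {k = k} xs ys = trans (sym (map-∘ _ _ (allFin k)))
  (trans (map-cong (lookup-++ˡ xs ys) (allFin k)) (map-lookup-allFin xs))

map-lookup-↑ʳ : {A : Set ℓ} (xs : Vec A k) (ys : Vec A n) →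
                map (lookup (xs ++ ys)) (map (k ↑ʳ_) (allFin n)) ≡ ys
map-lookup-↑ʳ {n = n} xs ys = trans (sym (map-∘ _ _ (allFin n)))
  (trans (map-cong (lookup-++ʳ xs ys) (allFin n)) (map-lookup-allFin ys))

-- Formulas over parameters list the free variables first and the parameters after them; the two
-- parts are renamed separately.
_⊕_ : ∀ {j l} → Vec (Fin k) j → Vec (Fin n) l → Vec (Fin (k + n)) (j + l)
_⊕_ {k = k} {n = n} ρ σ = map (_↑ˡ n) ρ ++ map (k ↑ʳ_) σ

map-lookup-⊕ : {A : Set ℓ} (xs : Vec A k) (ys : Vec A n) → ∀ {j l} (ρ : Vec (Fin k) j) (σ : Vec (Fin n) l) →
               map (lookup (xs ++ ys)) (ρ ⊕ σ) ≡ map (lookup xs) ρ ++ map (lookup ys) σ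
map-lookup-⊕ {k = k} {n = n} xs ys ρ σ = trans (map-++ _ (map (_↑ˡ n) ρ) (map (k ↑ʳ_) σ)) (cong₂ _++_
  (trans (sym (map-∘ _ _ ρ)) (map-cong (lookup-++ˡ xs ys) ρ))
  (trans (sym (map-∘ _ _ σ)) (map-cong (lookup-++ʳ xs ys) σ)))

-- Renaming of variables

module _ {L : Language ℓ} where

  renameTerm  : Vec (Fin k) n → Term L n → Term L k
  renameTerms : ∀ {j} → Vec (Fin k) n → Vec (Term L n) j → Vec (Term L k) j
  renameTerm ρ (var i)    = var (lookup ρ i)
  renameTerm ρ (app f ts) = app f (renameTerms ρ ts)
  renameTerms ρ []        = []
  renameTerms ρ (t ∷ ts)  = renameTerm ρ t ∷ renameTerms ρ ts

  underBinder : Vec (Fin k) n → Vec (Fin (ℕ.suc k)) (ℕ.suc n)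
  underBinder ρ = Fin.zero ∷ map Fin.suc ρ

  rename : Vec (Fin k) n → Formula L n → Formula L k
  rename ρ ⊥ᶠ          = ⊥ᶠ
  rename ρ (s ≈ᶠ t)    = renameTerm ρ s ≈ᶠ renameTerm ρ t
  rename ρ (relᶠ R ts) = relᶠ R (renameTerms ρ ts)
  rename ρ (φ ∧ᶠ ψ)    = rename ρ φ ∧ᶠ rename ρ ψ
  rename ρ (φ ∨ᶠ ψ)    = rename ρ φ ∨ᶠ rename ρ ψ
  rename ρ (φ ⇒ᶠ ψ)    = rename ρ φ ⇒ᶠ rename ρ ψ
  rename ρ (∀ᶠ φ)      = ∀ᶠ rename (underBinder ρ) φ
  rename ρ (∃ᶠ φ)      = ∃ᶠ rename (underBinder ρ) φ

  infixr 5 _⇔ᶠ_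

  _⇔ᶠ_ : Formula L n → Formula L n → Formula L n
  φ ⇔ᶠ ψ = (φ ⇒ᶠ ψ) ∧ᶠ (ψ ⇒ᶠ φ)

  module _ (M : Structure L) where

    eval-rename : (ρ : Vec (Fin k) n) (xs : Vec (Carrier M) k) (t : Term L n) →
                  eval M xs (renameTerm ρ t) ≡ eval M (map (lookup xs) ρ) t
    evals-rename : ∀ {j} (ρ : Vec (Fin k) n) (xs : Vec (Carrier M) k) (ts : Vec (Term L n) j) →
                   evals M xs (renameTerms ρ ts) ≡ evals M (map (lookup xs) ρ) ts
    eval-rename ρ xs (var i)     = sym (lookup-map i (lookup xs) ρ)
    eval-rename ρ xs (app f ts)  = cong (funⁱ M f) (evals-rename ρ xs ts)
    evals-rename ρ xs []         = refl
    evals-rename ρ xs (t ∷ ts)   = cong₂ _∷_ (eval-rename ρ xs t) (evals-rename ρ xs ts)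

    ⊨-cong : (φ : Formula L n) {xs ys : Vec (Carrier M) n} → xs ≡ ys →
             (M ⊨ φ [ xs ]) ⇔ (M ⊨ φ [ ys ])
    ⊨-cong φ refl = ⇔-id _

    ⊨-rename : (ρ : Vec (Fin k) n) (φ : Formula L n) (xs : Vec (Carrier M) k) →
               (M ⊨ rename ρ φ [ xs ]) ⇔ (M ⊨ φ [ map (lookup xs) ρ ])
    ⊨-rename-underBinder : (ρ : Vec (Fin k) n) (φ : Formula L (ℕ.suc n)) (xs : Vec (Carrier M) k) →
                    ∀ x → (M ⊨ rename (underBinder ρ) φ [ x ∷ xs ]) ⇔ (M ⊨ φ [ x ∷ map (lookup xs) ρ ])
    ⊨-rename-underBinder ρ φ xs x =
      ⊨-cong φ (cong (x ∷_) (sym (map-∘ (lookup (x ∷ xs)) Fin.suc ρ))) ⇔-∘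
      ⊨-rename (underBinder ρ) φ (x ∷ xs)
    ⊨-rename ρ ⊥ᶠ          xs = ⇔-id _
    ⊨-rename ρ (s ≈ᶠ t)    xs = ≡⇒⇔ (cong₂ _≡_ (eval-rename ρ xs s) (eval-rename ρ xs t))
    ⊨-rename ρ (relᶠ R ts) xs = ≡⇒⇔ (cong (relⁱ M R) (evals-rename ρ xs ts))
    ⊨-rename ρ (φ ∧ᶠ ψ)    xs = ⊨-rename ρ φ xs ×-⇔ ⊨-rename ρ ψ xs
    ⊨-rename ρ (φ ∨ᶠ ψ)    xs = ⊨-rename ρ φ xs ⊎-⇔ ⊨-rename ρ ψ xs
    ⊨-rename ρ (φ ⇒ᶠ ψ)    xs = →-cong-⇔ (⊨-rename ρ φ xs) (⊨-rename ρ ψ xs)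
    ⊨-rename ρ (∀ᶠ φ)      xs = ∀-cong-⇔ (⊨-rename-underBinder ρ φ xs)
    ⊨-rename ρ (∃ᶠ φ)      xs = ∃-cong-⇔ (⊨-rename-underBinder ρ φ xs)

  module _ {M N : Structure L} (f : Isomorphism M N) where
    private module F = Isomorphism f

    eval-iso : (xs : Vec (Carrier M) n) (t : Term L n) →
               F.to (eval M xs t) ≡ eval N (map F.to xs) t
    evals-iso : (xs : Vec (Carrier M) n) (ts : Vec (Term L n) k) →
                map F.to (evals M xs ts) ≡ evals N (map F.to xs) ts
    eval-iso xs (var i)    = sym (lookup-map i F.to xs)
    eval-iso xs (app g ts) = trans (F.fun-pres g _) (cong (funⁱ N g) (evals-iso xs ts))
    evals-iso xs []        = refl
    evals-iso xs (t ∷ ts)  = cong₂ _∷_ (eval-iso xs t) (evals-iso xs ts)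

    -- Injectivity carries equations back and surjectivity reaches every witness, so quantified
    -- formulas are preserved as well.
    ⊨-iso : (φ : Formula L n) (xs : Vec (Carrier M) n) →
            (M ⊨ φ [ xs ]) ⇔ (N ⊨ φ [ map F.to xs ])
    ⊨-iso ⊥ᶠ          xs = mk⇔ (λ ()) (λ ())
    ⊨-iso (s ≈ᶠ t)    xs =
      ≡⇒⇔ (cong₂ _≡_ (eval-iso xs s) (eval-iso xs t)) ⇔-∘ mk⇔ (cong F.to) F.injective
    ⊨-iso (relᶠ R ts) xs = ≡⇒⇔ (cong (relⁱ N R) (evals-iso xs ts)) ⇔-∘ F.rel-pres R _
    ⊨-iso (φ ∧ᶠ ψ)    xs = ⊨-iso φ xs ×-⇔ ⊨-iso ψ xs
    ⊨-iso (φ ∨ᶠ ψ)    xs = ⊨-iso φ xs ⊎-⇔ ⊨-iso ψ xs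
    ⊨-iso (φ ⇒ᶠ ψ)    xs = →-cong-⇔ (⊨-iso φ xs) (⊨-iso ψ xs)
    ⊨-iso (∀ᶠ φ)      xs = mk⇔
      (λ h y → let x , eq = F.surjective y in
               subst (λ y → N ⊨ φ [ y ∷ map F.to xs ]) (eq refl) (to (⊨-iso φ (x ∷ xs)) (h x)))
      (λ h x → from (⊨-iso φ (x ∷ xs)) (h (F.to x)))
    ⊨-iso (∃ᶠ φ)      xs = mk⇔
      (λ (x , h) → F.to x , to (⊨-iso φ (x ∷ xs)) h)
      (λ (y , h) → let x , eq = F.surjective y in
               x , from (⊨-iso φ (x ∷ xs)) (subst (λ y → N ⊨ φ [ y ∷ map F.to xs ]) (sym (eq refl)) h))

-- Tuples of the same type over the empty set

module _ {L : Language ℓ} where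

  evals-var : (M : Structure L) (xs : Vec (Carrier M) n) (ρ : Vec (Fin n) k) →
              evals M xs (map var ρ) ≡ map (lookup xs) ρ
  evals-var M xs []      = refl
  evals-var M xs (i ∷ ρ) = cong (lookup xs i ∷_) (evals-var M xs ρ)

  infix 4 _⊢_≋_

  -- Equality of types over the empty set in terms of plain formulas: the members of `tp M ∅` still
  -- carry a parameter vector, though an empty one.
  _⊢_≋_ : (M : Structure L) → Vec (Carrier M) n → Vec (Carrier M) n → Set ℓ
  _⊢_≋_ {n = n} M xs ys = (φ : Formula L n) → (M ⊨ φ [ xs ]) ⇔ (M ⊨ φ [ ys ])

  ≋⇒tp : (M : Structure L) {xs ys : Vec (Carrier M) n} → M ⊢ xs ≋ ys → tp M ∅ xs ≐ tp M ∅ ys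
  ≋⇒tp {n = n} M xs≋ys = (λ {φ} → to (at φ)) , (λ {φ} → from (at φ))
    where
    -- A formula over the empty set has n + 0 variables, which does not compute to n; renaming along
    -- `allFin n ++ []` changes the arity without a transport.
    widen : (zs : Vec (Carrier M) n) → map (lookup zs) (allFin n ++ []) ≡ zs ++ []
    widen zs = trans (map-++ (lookup zs) (allFin n) []) (cong (_++ []) (map-lookup-allFin zs))
    at : (φ : FormulaOver M ∅ n) → tp M ∅ _ φ ⇔ tp M ∅ _ φ
    at record { formula = φ ; params = [] } =
      (⊨-cong M φ (widen _) ⇔-∘ ⊨-rename M (allFin n ++ []) φ _) ⇔-∘
      (xs≋ys (rename (allFin n ++ []) φ) ⇔-∘
      ⇔-sym (⊨-cong M φ (widen _) ⇔-∘ ⊨-rename M (allFin n ++ []) φ _))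
    at record { params = _ ∷ _ ; params∈A = () ∷ _ }

  parameterFree : (M : Structure L) {A : Pred (Carrier M) a} → Formula L n → FormulaOver M A n
  parameterFree {n = n} M φ = record
    { formula = rename (map (_↑ˡ 0) (allFin n)) φ ; params = [] ; params∈A = [] }

  Solutions-parameterFree :
    (M : Structure L) {A : Pred (Carrier M) a} (φ : Formula L n) (xs : Vec (Carrier M) n) →
    Solutions M {A = A} (parameterFree M φ) xs ⇔ (M ⊨ φ [ xs ])
  Solutions-parameterFree {n = n} M φ xs =
    ⊨-cong M φ (map-lookup-↑ˡ xs []) ⇔-∘ ⊨-rename M (map (_↑ˡ 0) (allFin n)) φ (xs ++ [])

  tp⇒≋ : (M : Structure L) {xs ys : Vec (Carrier M) n} → tp M ∅ xs ≐ tp M ∅ ys → M ⊢ xs ≋ ys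
  tp⇒≋ M (⊆ , ⊇) φ =
    Solutions-parameterFree M {∅} φ _ ⇔-∘
    (mk⇔ (⊆ {parameterFree M φ}) (⊇ {parameterFree M φ}) ⇔-∘
    ⇔-sym (Solutions-parameterFree M {∅} φ _))

-- The positions of the k blocks of length m in a concatenation.
blocks : ∀ k m → Vec (Vec (Fin (k * m)) m) k
blocks ℕ.zero    m = []
blocks (ℕ.suc k) m = map (_↑ˡ (k * m)) (allFin m) ∷ map (map (m ↑ʳ_)) (blocks k m)

map-map-∘ : ∀ {a b c} {A : Set a} {B : Set b} {C : Set c} {f : B → C} {g : A → B} {h : A → C} →
            (∀ x → f (g x) ≡ h x) → (xss : Vec (Vec A n) k) →
            map (map f) (map (map g) xss) ≡ map (map h) xss
map-map-∘ {f = f} {g} eq xss = trans (sym (map-∘ (map f) (map g) xss))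
  (map-cong (λ xs → trans (sym (map-∘ f g xs)) (map-cong eq xs)) xss)

map-lookup-blocks : ∀ {m} {A : Set ℓ} (xss : Vec (Vec A m) k) →
                    map (map (lookup (concat xss))) (blocks k m) ≡ xss
map-lookup-blocks []                                = refl
map-lookup-blocks {k = ℕ.suc k} {m = m} (xs ∷ xss) = cong₂ _∷_
  (map-lookup-↑ˡ xs (concat xss))
  (trans (map-map-∘ (lookup-++ʳ xs (concat xss)) (blocks k m)) (map-lookup-blocks xss))

-- When every point is replaced by its m coordinates, a selection σ of points becomes this renaming
-- of variables.
selectBlocks : ∀ m → Vec (Fin k) n → Vec (Fin (k * m)) (n * m)
selectBlocks {k = k} m σ = concat (map (lookup (blocks k m)) σ)

map-lookup-selectBlocks : ∀ {m} {A : Set ℓ} (xss : Vec (Vec A m) k) (σ : Vec (Fin k) n) →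
  map (lookup (concat xss)) (selectBlocks m σ) ≡ concat (map (lookup xss) σ)
map-lookup-selectBlocks {k = k} {m = m} xss σ = begin
  map (lookup (concat xss)) (selectBlocks m σ)
    ≡⟨ map-concat _ (map (lookup (blocks k m)) σ) ⟩
  concat (map (map (lookup (concat xss))) (map (lookup (blocks k m)) σ))
    ≡⟨ cong concat (map-lookup-map _ (blocks k m) σ) ⟨
  concat (map (lookup (map (map (lookup (concat xss))) (blocks k m))) σ)
    ≡⟨ cong (λ yss → concat (map (lookup yss) σ)) (map-lookup-blocks xss) ⟩
  concat (map (lookup xss) σ) ∎
  where open ≡-Reasoning

-- Formulas over A as definable sets

module _ {L : Language ℓ} {M : Structure L} where
  open FormulaOver

  module _ (k : ℕ) {i j : ℕ} where

    -- Two formulas in the same k variables, each with its own parameters, are brought over the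
    -- joint vector `as ++ bs` before they are combined.
    injectˡ : Formula L (k + i) → Formula L (k + (i + j))
    injectˡ = rename (allFin k ⊕ map (_↑ˡ j) (allFin i))

    injectʳ : Formula L (k + j) → Formula L (k + (i + j))
    injectʳ = rename (allFin k ⊕ map (i ↑ʳ_) (allFin j))

    module _ (xs : Vec (Carrier M) k) (as : Vec (Carrier M) i) (bs : Vec (Carrier M) j) where

      ⊨-injectˡ : ∀ φ → (M ⊨ injectˡ φ [ xs ++ (as ++ bs) ]) ⇔ (M ⊨ φ [ xs ++ as ])
      ⊨-injectˡ φ = ⊨-cong M φ
        (trans (map-lookup-⊕ xs (as ++ bs) (allFin k) (map (_↑ˡ j) (allFin i)))
               (cong₂ _++_ (map-lookup-allFin xs) (map-lookup-↑ˡ as bs)))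
        ⇔-∘ ⊨-rename M (allFin k ⊕ map (_↑ˡ j) (allFin i)) φ _

      ⊨-injectʳ : ∀ φ → (M ⊨ injectʳ φ [ xs ++ (as ++ bs) ]) ⇔ (M ⊨ φ [ xs ++ bs ])
      ⊨-injectʳ φ = ⊨-cong M φ
        (trans (map-lookup-⊕ xs (as ++ bs) (allFin k) (map (i ↑ʳ_) (allFin j)))
               (cong₂ _++_ (map-lookup-allFin xs) (map-lookup-↑ʳ as bs)))
        ⇔-∘ ⊨-rename M (allFin k ⊕ map (i ↑ʳ_) (allFin j)) φ _

  -- Finitely many formulas involve finitely many parameters. Pooled into one tuple, these can later
  -- be treated as unknowns.
  commonParameters : ∀ {r} {arity : Fin r → ℕ} (ψ : ∀ j → FormulaOver M U (arity j)) →
    ∃ λ p → Σ (Vec (Carrier M) p) λ as → ∀ j → Σ (Formula L (arity j + p)) λ θ →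
      ∀ xs → Solutions M (ψ j) xs ⇔ (M ⊨ θ [ xs ++ as ])
  commonParameters {ℕ.zero}  ψ = 0 , [] , λ ()
  commonParameters {ℕ.suc r} {arity} ψ =
    let p , as , θ = commonParameters (ψ ∘ Fin.suc) ; ψ₀ = ψ Fin.zero in
    _ , params ψ₀ ++ as , λ where
      Fin.zero    → injectˡ (arity Fin.zero) (formula ψ₀) ,
        λ xs → ⇔-sym (⊨-injectˡ (arity Fin.zero) xs (params ψ₀) as (formula ψ₀))
      (Fin.suc j) → injectʳ (arity (Fin.suc j)) (proj₁ (θ j)) ,
        λ xs → ⇔-sym (⊨-injectʳ (arity (Fin.suc j)) xs (params ψ₀) as (proj₁ (θ j))) ⇔-∘ proj₂ (θ j) xs

  module _ {A : Pred (Carrier M) a} where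

    merge : (∀ {n} → Formula L n → Formula L n → Formula L n) →
            FormulaOver M A k → FormulaOver M A k → FormulaOver M A k
    merge {k} _∙_ φ ψ = record
      { formula  = injectˡ k (formula φ) ∙ injectʳ k (formula ψ)
      ; params   = params φ ++ params ψ
      ; params∈A = AllProps.++⁺ (params∈A φ) (params∈A ψ)
      }

    complement : FormulaOver M A k → FormulaOver M A k
    complement φ = record { formula = ¬ᶠ formula φ ; params = params φ ; params∈A = params∈A φ }

    module _ {k : ℕ} {D : Set ℓ} (φ : D → FormulaOver M A k) where

      ⋂ ⋃ : List D → FormulaOver M A k
      ⋂ []       = parameterFree M (⊥ᶠ ⇒ᶠ ⊥ᶠ)
      ⋂ (d ∷ ds) = merge _∧ᶠ_ (φ d) (⋂ ds)
      ⋃ []       = parameterFree M ⊥ᶠ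
      ⋃ (d ∷ ds) = merge _∨ᶠ_ (φ d) (⋃ ds)

      Solutions-⋂ : ∀ ds xs → Solutions M (⋂ ds) xs ⇔ ListAll.All (λ d → Solutions M (φ d) xs) ds
      Solutions-⋂ []       xs = mk⇔ (λ _ → []) (λ _ x → x)
      Solutions-⋂ (d ∷ ds) xs = mk⇔ (λ (y , ys) → y ∷ ys) (λ { (y ∷ ys) → y , ys }) ⇔-∘
        (⊨-injectˡ k xs (params (φ d)) (params (⋂ ds)) (formula (φ d)) ×-⇔
        (Solutions-⋂ ds xs ⇔-∘ ⊨-injectʳ k xs (params (φ d)) (params (⋂ ds)) (formula (⋂ ds))))

      Solutions-⋃ : ∀ ds xs → Solutions M (⋃ ds) xs ⇔ Any.Any (λ d → Solutions M (φ d) xs) ds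
      Solutions-⋃ []       xs = mk⇔ (λ ()) (λ ())
      Solutions-⋃ (d ∷ ds) xs =
        mk⇔ (λ { (inj₁ y) → here y ; (inj₂ y) → there y }) (λ { (here y) → inj₁ y ; (there y) → inj₂ y }) ⇔-∘
        (⊨-injectˡ k xs (params (φ d)) (params (⋃ ds)) (formula (φ d)) ⊎-⇔
        (Solutions-⋃ ds xs ⇔-∘ ⊨-injectʳ k xs (params (φ d)) (params (⋃ ds)) (formula (⋃ ds))))

    module _ {q m : ℕ} (φ : FormulaOver M A ((k + q) * m)) (wss : Vec (Vec (Carrier M) m) q) where

      -- Fixes the last q points, whose images join the parameters. The images need not lie in A,
      -- hence the target `U`.
      substitute : FormulaOver M U (k * m)
      substitute = record
        { formula  = rename ρ (formula φ)
        ; params   = concat wss ++ params φ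
        ; params∈A = All.universal _ _
        }
        where
        -- Order of the new variables: coordinates of the k free points, coordinates of the q fixed
        -- points, old parameters.
        ρ : Vec (Fin (k * m + (q * m + numParams φ))) ((k + q) * m + numParams φ)
        ρ = concat (map (map (_↑ˡ _)) (blocks k m) ++ map (map (λ i → k * m ↑ʳ (i ↑ˡ _))) (blocks q m)) ++
            map (λ i → k * m ↑ʳ (q * m ↑ʳ i)) (allFin _)

      Solutions-substitute : ∀ xss →
        Solutions M substitute (concat xss) ⇔ Solutions M φ (concat (xss ++ wss))
      Solutions-substitute xss = ⊨-cong M (formula φ) eq ⇔-∘ ⊨-rename M _ (formula φ) V
        where
        ps = params φ
        V = concat xss ++ (concat wss ++ ps)
        eqˡ : map (map (lookup V)) (map (map (_↑ˡ _)) (blocks k m)) ≡ xss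
        eqˡ = trans (map-map-∘ (lookup-++ˡ (concat xss) (concat wss ++ ps)) (blocks k m)) (map-lookup-blocks xss)
        eqʳ : map (map (lookup V)) (map (map (λ i → k * m ↑ʳ (i ↑ˡ _))) (blocks q m)) ≡ wss
        eqʳ = trans (map-map-∘ (λ i → trans (lookup-++ʳ (concat xss) (concat wss ++ ps) (i ↑ˡ _))
                                            (lookup-++ˡ (concat wss) ps i)) (blocks q m)) (map-lookup-blocks wss)
        eqᵖ : map (lookup V) (map (λ i → k * m ↑ʳ (q * m ↑ʳ i)) (allFin _)) ≡ ps
        eqᵖ = trans (sym (map-∘ _ _ (allFin _)))
          (trans (map-cong (λ i → trans (lookup-++ʳ (concat xss) (concat wss ++ ps) (q * m ↑ʳ i))
                                         (lookup-++ʳ (concat wss) ps i)) (allFin _)) (map-lookup-allFin ps))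
        eq : map (lookup V) (concat (map (map (_↑ˡ _)) (blocks k m) ++ map (map (λ i → k * m ↑ʳ (i ↑ˡ _))) (blocks q m)) ++
               map (λ i → k * m ↑ʳ (q * m ↑ʳ i)) (allFin _)) ≡ concat (xss ++ wss) ++ ps
        eq = trans (map-++ (lookup V) (concat (map (map (_↑ˡ _)) (blocks k m) ++ _)) _) (cong₂ _++_
          (trans (map-concat (lookup V) (map (map (_↑ˡ _)) (blocks k m) ++ _))
            (cong concat (trans (map-++ (map (lookup V)) (map (map (_↑ˡ _)) (blocks k m)) _) (cong₂ _++_ eqˡ eqʳ))))
          eqᵖ)

-- Compactness

-- prefix s n lists s (n - 1), …, s 0: the last value comes first, so that
-- the values of s from position n on are the first variables to be quantified.
prefix : {C : Set ℓ} → (ℕ → C) → (n : ℕ) → Vec C n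
prefix s ℕ.zero    = []
prefix s (ℕ.suc n) = s n ∷ prefix s n

place : ∀ {v} → v <′ n → Fin n
place ≤′-refl       = Fin.zero
place (≤′-step v<n) = Fin.suc (place v<n)

lookup-place : {C : Set ℓ} (s : ℕ → C) {v : ℕ} (v<n : v <′ n) →
               lookup (prefix s n) (place v<n) ≡ s v
lookup-place s ≤′-refl       = refl
lookup-place s (≤′-step v<n) = lookup-place s v<n

prefix-cong : {C : Set ℓ} {s t : ℕ → C} → (∀ v → v < n → s v ≡ t v) → prefix s n ≡ prefix t n
prefix-cong {n = ℕ.zero}  eq = refl
prefix-cong {n = ℕ.suc n} eq =
  cong₂ _∷_ (eq n ℕ.≤-refl) (prefix-cong (λ v v<n → eq v (ℕ.m<n⇒m<1+n v<n)))

prefix-+ : {C : Set ℓ} (s : ℕ → C) (k : ℕ) → ∃ λ ys → prefix s (k + n) ≡ ys ++ prefix s n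
prefix-+ s ℕ.zero    = [] , refl
prefix-+ s (ℕ.suc k) = let ys , eq = prefix-+ s k in _ ∷ ys , cong (_ ∷_) eq

prefix-surjective : {C : Set ℓ} → C → (c : Vec C n) → ∃ λ s → prefix s n ≡ c
-- `d` fills the positions from n on, which the prefix does not see.
prefix-surjective d []                    = (λ _ → d) , refl
prefix-surjective {n = ℕ.suc n} d (x ∷ c) = let s , eq = prefix-surjective d c in
  t s , cong₂ _∷_ (at-n s) (trans (prefix-cong (below s)) eq)
  where
  t : (ℕ → _) → ℕ → _
  t s v with v ℕ.≟ n
  ... | yes _ = x
  ... | no  _ = s v
  at-n : ∀ s → t s n ≡ x
  at-n s with n ℕ.≟ n
  ... | yes _  = refl
  ... | no n≢n = contradiction refl n≢n
  below : ∀ s v → v < n → t s v ≡ s v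
  below s v v<n with v ℕ.≟ n
  ... | yes refl = contradiction v<n (ℕ.<-irrefl refl)
  ... | no  _    = refl

bound : (vs : Vec ℕ n) → ∃ λ b → All (_<′ b) vs
bound []       = 0 , []
bound (v ∷ vs) = let b , vs<b = bound vs in
  ℕ.suc v ⊔ b ,
  ℕ.≤⇒≤′ (ℕ.m≤m⊔n (ℕ.suc v) b) ∷
  All.map (λ v<b → ℕ.≤⇒≤′ (ℕ.≤-trans (ℕ.≤′⇒≤ v<b) (ℕ.m≤n⊔m (ℕ.suc v) b))) vs<b

module _ {L : Language ℓ} where

  infix 3 _at_

  -- A condition on an infinite sequence of unknowns, which `vars` names by number, in any order and
  -- with repetitions.
  record Instance : Set ℓ where
    constructor _at_
    field
      {arity} : ℕ
      formula : Formula L arity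
      vars    : Vec ℕ arity

  infix 4 _,_⊩_ _,_⊩ₚ_

  _,_⊩_ : (M : Structure L) → (ℕ → Carrier M) → Instance → Set ℓ
  M , s ⊩ (φ at vs) = M ⊨ φ [ map s vs ]

  -- With every condition stated about an initial segment of the unknowns, conjunction and
  -- projection only have to adjust lengths.
  PrefixFormula : Set ℓ
  PrefixFormula = ∃ (Formula L)

  _,_⊩ₚ_ : (M : Structure L) → (ℕ → Carrier M) → PrefixFormula → Set ℓ
  M , s ⊩ₚ (n , φ) = M ⊨ φ [ prefix s n ]

  onPrefix : Instance → PrefixFormula
  onPrefix (φ at vs) = let b , vs<b = bound vs in b , rename (All.reduce place vs<b) φ

  -- The length is b + n instead of a maximum: a prefix of that length ends in the prefixes of
  -- lengths b and n alike, with no case distinction.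
  widen : ∀ n ((b , _) : PrefixFormula) → Formula L (b + n)
  widen n (b , φ) = subst (Formula L) (ℕ.+-comm n b) (rename (map (n ↑ʳ_) (allFin b)) φ)

  conj : List PrefixFormula → PrefixFormula
  conj []       = 0 , ⊥ᶠ ⇒ᶠ ⊥ᶠ
  conj (φ ∷ Δ) = let ψ = conj Δ in
    _ , widen (proj₁ ψ) φ ∧ᶠ subst (Formula L) (ℕ.+-comm (proj₁ ψ) (proj₁ φ)) (widen (proj₁ φ) ψ)

  ∃* : ∀ k → Formula L (k + n) → Formula L n
  ∃* ℕ.zero    φ = φ
  ∃* (ℕ.suc k) φ = ∃* k (∃ᶠ φ)

  -- The projection of φ to the first n unknowns. For n = 0 it is a sentence, the form in which
  -- satisfiability passes from one model to another.
  realised : ∀ n → PrefixFormula → Formula L n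
  realised n φ = ∃* (proj₁ φ) (widen n φ)

  module _ (M : Structure L) where

    onPrefix-⊩ : ∀ s φ → (M , s ⊩ₚ onPrefix φ) ⇔ (M , s ⊩ φ)
    onPrefix-⊩ s (φ at vs) = let b , vs<b = bound vs in
      ⊨-cong M φ (lookup-places vs<b) ⇔-∘ ⊨-rename M (All.reduce place vs<b) φ (prefix s b)
      where
      lookup-places : ∀ {b n} {vs : Vec ℕ n} (vs<b : All (_<′ b) vs) →
                      map (lookup (prefix s b)) (All.reduce place vs<b) ≡ map s vs
      lookup-places []           = refl
      lookup-places (v<b ∷ vs<b) = cong₂ _∷_ (lookup-place s v<b) (lookup-places vs<b)

    ⊩ₚ-subst : ∀ s {j k} (eq : j ≡ k) (φ : Formula L j) →
               (M , s ⊩ₚ (k , subst (Formula L) eq φ)) ⇔ (M , s ⊩ₚ (j , φ))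
    ⊩ₚ-subst s refl φ = ⇔-id _

    widen-⊩ : ∀ s n φ → (M , s ⊩ₚ (proj₁ φ + n , widen n φ)) ⇔ (M , s ⊩ₚ φ)
    widen-⊩ s n (b , φ) =
      ⊨-cong M φ eq ⇔-∘ (⊨-rename M (map (n ↑ʳ_) (allFin b)) φ _ ⇔-∘ ⊩ₚ-subst s (ℕ.+-comm n b) _)
      where
      eq : map (lookup (prefix s (n + b))) (map (n ↑ʳ_) (allFin b)) ≡ prefix s b
      eq with ys , eq′ ← prefix-+ {n = b} s n rewrite eq′ =
        map-lookup-↑ʳ ys (prefix s b)

    conj-⊩ : ∀ s Δ → (M , s ⊩ₚ conj Δ) ⇔ ListAll.All (M , s ⊩ₚ_) Δ
    conj-⊩ s []      = mk⇔ (λ _ → []) (λ _ x → x)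
    conj-⊩ s (φ ∷ Δ) =
      mk⇔ (λ (x , xs) → x ∷ xs) (λ { (x ∷ xs) → x , xs }) ⇔-∘
      (widen-⊩ s (proj₁ (conj Δ)) φ ×-⇔ (conj-⊩ s Δ ⇔-∘ (widen-⊩ s (proj₁ φ) (conj Δ) ⇔-∘
        ⊩ₚ-subst s (ℕ.+-comm (proj₁ (conj Δ)) (proj₁ φ)) _)))

    ⊨-∃* : ∀ k (φ : Formula L (k + n)) (c : Vec (Carrier M) n) →
           (M ⊨ ∃* k φ [ c ]) ⇔ (∃ λ ys → M ⊨ φ [ ys ++ c ])
    ⊨-∃* ℕ.zero    φ c = mk⇔ (λ h → [] , h) (λ { ([] , h) → h })
    ⊨-∃* (ℕ.suc k) φ c =
      mk⇔ (λ (ys , y , h) → y ∷ ys , h) (λ { (y ∷ ys , h) → ys , y , h }) ⇔-∘ ⊨-∃* k (∃ᶠ φ) c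

    ⊨-realised : ∀ n φ (c : Vec (Carrier M) n) →
                 (M ⊨ realised n φ [ c ]) ⇔ (∃ λ s → prefix s n ≡ c × M , s ⊩ₚ φ)
    ⊨-realised n φ@(b , _) c = mk⇔ forth back ⇔-∘ ⊨-∃* b (widen n φ) c
      where
      forth : (∃ λ ys → M ⊨ widen n φ [ ys ++ c ]) → ∃ λ s → prefix s n ≡ c × M , s ⊩ₚ φ
      forth (ys , h) with s , eq ← prefix-surjective (nonempty M) (ys ++ c)
                     with zs , eq′ ← prefix-+ {n = n} s b =
        s , ++-injectiveʳ zs ys (trans (sym eq′) eq) ,
        to (widen-⊩ s n φ) (subst (M ⊨ widen n φ [_]) (sym eq) h)
      back : (∃ λ s → prefix s n ≡ c × M , s ⊩ₚ φ) → ∃ λ ys → M ⊨ widen n φ [ ys ++ c ]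
      back (s , refl , h) with ys , eq ← prefix-+ {n = n} s b =
        ys , subst (M ⊨ widen n φ [_]) eq (from (widen-⊩ s n φ) h)

  -- The part of saturation that a construction by stages consumes: at each stage only the finitely
  -- many values already chosen serve as parameters.
  SaturatedOverTuples : Structure L → Set (suc ℓ)
  SaturatedOverTuples M =
    ∀ {n} (c : Vec (Carrier M) n) (p : Pred (Formula L (ℕ.suc n)) ℓ) →
    (∀ Δ → ListAll.All p Δ → ∃ λ x → ListAll.All (λ φ → M ⊨ φ [ x ∷ c ]) Δ) →
    ∃ λ x → ∀ φ → p φ → M ⊨ φ [ x ∷ c ]

  module Compactness
    {N M : Structure L} (N⇒M : (φ : Sentence L) → N ⊨ φ [ [] ] → M ⊨ φ [ [] ])
    (saturated : SaturatedOverTuples M)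
    {C : Set ℓ} (inst : C → Instance) (Γ : Pred C ℓ)
    (satisfiable : ∀ Δ → ListAll.All Γ Δ → ∃ λ s → ListAll.All (λ γ → N , s ⊩ inst γ) Δ)
    where

    conjunction : List C → PrefixFormula
    conjunction Δ = conj (List.map (onPrefix ∘ inst) Δ)

    conjunction-⊩ : (M : Structure L) → ∀ s Δ →
      (M , s ⊩ₚ conjunction Δ) ⇔ ListAll.All (λ γ → M , s ⊩ inst γ) Δ
    conjunction-⊩ M s Δ = mk⇔ (forth Δ) (back Δ) ⇔-∘ conj-⊩ M s _
      where
      forth : ∀ Δ → ListAll.All (M , s ⊩ₚ_) (List.map (onPrefix ∘ inst) Δ) →
              ListAll.All (λ γ → M , s ⊩ inst γ) Δ
      forth []      []       = []
      forth (γ ∷ Δ) (h ∷ hs) = to (onPrefix-⊩ M s (inst γ)) h ∷ forth Δ hs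
      back : ∀ Δ → ListAll.All (λ γ → M , s ⊩ inst γ) Δ →
             ListAll.All (M , s ⊩ₚ_) (List.map (onPrefix ∘ inst) Δ)
      back []      []       = []
      back (γ ∷ Δ) (h ∷ hs) = from (onPrefix-⊩ M s (inst γ)) h ∷ back Δ hs

    -- The invariant of the construction: fixing the values c has not destroyed finite
    -- satisfiability.
    Extendible : Vec (Carrier M) n → Set ℓ
    Extendible {n} c = ∀ Δ → ListAll.All Γ Δ →
      ∃ λ s → prefix s n ≡ c × ListAll.All (λ γ → M , s ⊩ inst γ) Δ

    extendible-[] : Extendible []
    extendible-[] Δ Δ⊆Γ =
      let s , h = satisfiable Δ Δ⊆Γ
          t , eq , h′ = to (⊨-realised M 0 (conjunction Δ) [])
            (N⇒M (realised 0 (conjunction Δ)) (from (⊨-realised N 0 (conjunction Δ) [])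
              (s , refl , from (conjunction-⊩ N s Δ) h)))
      in t , eq , to (conjunction-⊩ M t Δ) h′

    module _ {c : Vec (Carrier M) n} (ext : Extendible c) where

      -- What the next value has to satisfy: the projections of all finite parts of Γ to the first n
      -- + 1 unknowns.
      NextType : Pred (Formula L (ℕ.suc n)) ℓ
      NextType φ = ∃ λ Δ → ListAll.All Γ Δ × φ ≡ realised (ℕ.suc n) (conjunction Δ)

      -- Finitely many projections come from finitely many finite parts, and the union of these is
      -- one finite part. So `NextType` is finitely satisfiable over c.
      gather : ∀ {Φ} → ListAll.All NextType Φ → ∃ λ Δ → ListAll.All Γ Δ ×
        (∀ s → ListAll.All (λ γ → M , s ⊩ inst γ) Δ →
         ListAll.All (λ φ → M ⊨ φ [ prefix s (ℕ.suc n) ]) Φ)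
      gather []                        = [] , [] , λ s _ → []
      gather ((Δ , Δ⊆Γ , refl) ∷ rest) = let Δ′ , Δ′⊆Γ , h = gather rest in
        Δ List.++ Δ′ , ++⁺ₗ Δ⊆Γ Δ′⊆Γ , λ s hs → let hs₁ , hs₂ = ++⁻ₗ Δ hs in
        from (⊨-realised M (ℕ.suc n) (conjunction Δ) _)
          (s , refl , from (conjunction-⊩ M s Δ) hs₁) ∷ h s hs₂

      extend : ∃ λ x → Extendible (x ∷ c)
      extend with x , h ← saturated c NextType (λ Φ Φ⊆ →
                    let Δ , Δ⊆Γ , h = gather Φ⊆ ; s , eq , hs = ext Δ Δ⊆Γ in
                    -- The prefix of s of length n is c, so the entry at position n is the value
                    -- sought.
                    s n , subst (λ c → ListAll.All (λ φ → M ⊨ φ [ s n ∷ c ]) Φ) eq (h s hs)) =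
        x , λ Δ Δ⊆Γ →
          let s , eq , hs = to (⊨-realised M (ℕ.suc n) (conjunction Δ) (x ∷ c))
                               (h _ (Δ , Δ⊆Γ , refl))
          in s , eq , to (conjunction-⊩ M s Δ) hs

    chain : ∀ n → ∃ λ (c : Vec (Carrier M) n) → Extendible c
    chain ℕ.zero    = [] , extendible-[]
    chain (ℕ.suc n) = let _ , ext = chain n ; x , ext′ = extend ext in _ , ext′

    limit : ℕ → Carrier M
    limit n = proj₁ (extend (proj₂ (chain n)))

    prefix-limit : ∀ n → prefix limit n ≡ proj₁ (chain n)
    prefix-limit ℕ.zero    = refl
    prefix-limit (ℕ.suc n) = cong (limit n ∷_) (prefix-limit n)

    -- A condition sees only the first b unknowns, so it is settled at stage b of `chain`, by
    -- extendibility for this one condition.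
    compactness : ∃ λ s → ∀ γ → Γ γ → M , s ⊩ inst γ
    compactness = limit , λ γ γ∈Γ →
      let b = proj₁ (onPrefix (inst γ))
          s , eq , hs = proj₂ (chain b) (γ ∷ []) (γ∈Γ ∷ [])
      in to (onPrefix-⊩ M limit (inst γ))
           (subst (M ⊨ proj₂ (onPrefix (inst γ)) [_]) (trans eq (sym (prefix-limit b)))
             (from (onPrefix-⊩ M s (inst γ)) (ListAll.head hs)))

-- Finiteness, representatives and small parameter sets in classical logic

vectors : ∀ k n → List (Vec (Fin k) n)
vectors k ℕ.zero    = [] ∷ []
vectors k (ℕ.suc n) = List.cartesianProductWith _∷_ (List.allFin k) (vectors k n)

∈-vectors : (σ : Vec (Fin k) n) → σ ∈ vectors k n
∈-vectors []      = here refl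
∈-vectors (i ∷ σ) = ∈-cartesianProductWith⁺ _∷_ (∈-allFin i) (∈-vectors σ)

module Classical {ℓ} (EM : ExcludedMiddle (suc ℓ)) where

  em : {P : Set ℓ} → Dec P
  em {P} = map′ lower lift (EM {Lift (suc ℓ) P})

  -- As long as two indices share a value, one of them is deleted; once there are none, f is a
  -- bijection.
  finite-image : {C : Set ℓ} (f : Fin n → C) → (∀ x → ∃ λ i → f i ≡ x) → Finite C
  finite-image {n} f cover with em {Lift ℓ (∃₂ λ i j → i ≢ j × f i ≡ f j)}
  finite-image {n} f cover | no inj = n , ↔-sym (⤖⇒↔ (mk⤖ (
    (λ {i} {j} eq → decidable-stable (i ≟ᶠ j) λ i≢j → inj (lift (i , j , i≢j , eq))) ,
    λ x → proj₁ (cover x) , λ { refl → proj₂ (cover x) })))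
  finite-image {ℕ.suc n} f cover | yes (lift (i , j , i≢j , eq)) =
    finite-image (f ∘ Fin.punchIn j) cover′
    where
    cover′ : ∀ x → ∃ λ l → f (Fin.punchIn j l) ≡ x
    cover′ x with l , refl ← cover x with j ≟ᶠ l
    ... | no j≢l   = Fin.punchOut j≢l , cong f (punchIn-punchOut j≢l)
    ... | yes refl = Fin.punchOut (i≢j ∘ sym) , trans (cong f (punchIn-punchOut (i≢j ∘ sym))) eq

  -- Splitting Q along each predicate in turn leaves finitely many cells, and one element is taken
  -- from every cell that has any.
  representatives : {D : Set ℓ} (Q : Pred D ℓ) (Ps : List (Pred D ℓ)) →
    ∃ λ (reps : List (∃ Q)) → ∀ x → Q x →
      Any.Any (λ r → ListAll.All (λ P → P x ⇔ P (proj₁ r)) Ps) reps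
  representatives Q [] with em {∃ Q}
  ... | yes r = r ∷ [] , λ _ _ → here []
  ... | no ∄ = [] , λ x x∈Q → contradiction (x , x∈Q) ∄
  representatives {D} Q (P ∷ Ps) =
    let rs  , rs-cover  = representatives (λ x → Q x × P x) Ps
        rs′ , rs′-cover = representatives (λ x → Q x × ¬ P x) Ps
    in List.map forget rs List.++ List.map forget rs′ , λ x x∈Q → cover x x∈Q rs-cover rs′-cover em
    where
    forget : {R : Pred D ℓ} → ∃ (λ x → Q x × R x) → ∃ Q
    forget (x , x∈Q , _) = x , x∈Q
    cover : ∀ x → Q x → ∀ {rs rs′} →
      (∀ x → Q x × P x → Any.Any (λ r → ListAll.All (λ P → P x ⇔ P (proj₁ r)) Ps) rs) →
      (∀ x → Q x × ¬ P x → Any.Any (λ r → ListAll.All (λ P → P x ⇔ P (proj₁ r)) Ps) rs′) →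
      Dec (P x) → Any.Any (λ r → ListAll.All (λ P → P x ⇔ P (proj₁ r)) (P ∷ Ps))
                    (List.map forget rs List.++ List.map forget rs′)
    cover x x∈Q rs-cover _ (yes x∈P) = AnyProps.++⁺ˡ (AnyProps.map⁺
      (Any.map (λ {r} h → mk⇔ (λ _ → proj₂ (proj₂ r)) (λ _ → x∈P) ∷ h) (rs-cover x (x∈Q , x∈P))))
    cover x x∈Q {rs} _ rs′-cover (no x∉P) = AnyProps.++⁺ʳ (List.map forget rs) (AnyProps.map⁺
      (Any.map (λ {r} h → mk⇔ (λ x∈P → contradiction x∈P x∉P)
                              (λ r∈P → contradiction r∈P (proj₂ (proj₂ r))) ∷ h)
               (rs′-cover x (x∈Q , x∉P))))

  ∈⇒lookup-fromList : {C : Set ℓ} {x : C} {xs : List C} → x ∈ xs →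
                      ∃ λ i → lookup (Vec.fromList xs) i ≡ x
  ∈⇒lookup-fromList (here refl) = Fin.zero , refl
  ∈⇒lookup-fromList (there x∈)  = let i , eq = ∈⇒lookup-fromList x∈ in Fin.suc i , eq

  Range : {C : Set ℓ} → Vec C n → Pred C ℓ
  Range c x = ∃ λ i → lookup c i ≡ x

  module _ {K : Set ℓ} {X Y : Set ℓ} (large : setoid (X ⊎ Y ⊎ ℕ) ≺ setoid K) where

    -- The injection ι of ℕ into K serves both halves: positions in c are numbers, and an injection
    -- of K into the range would give one of ℕ into `Fin n`.
    Range-small : {C : Set ℓ} (c : Vec C n) → Small K (Range c)
    Range-small {n} {C} c =
      record
        { to        = ι ∘ code ∘ proj₁
        ; cong      = cong (ι ∘ code)
        ; injective = λ { {x , x∈} {y , y∈} eq → code-injective x∈ y∈ (ι-injective eq) }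
        } ,
      λ f → ℕ→Fin-notInjective (λ v → proj₁ (proj₂ (Injection.to f (ι v)))) λ {u} {v} eq →
        ι-injective (Injection.injective f (trans (sym (proj₂ (proj₂ (Injection.to f (ι u)))))
          (trans (cong (lookup c) eq) (proj₂ (proj₂ (Injection.to f (ι v)))))))
      where
      ι : ℕ → K
      ι v = Injection.to (proj₁ large) (inj₂ (inj₂ v))
      ι-injective : ∀ {u v} → ι u ≡ ι v → u ≡ v
      ι-injective eq with refl ← Injection.injective (proj₁ large) eq = refl
      -- Membership is decided afresh, so that the code depends on the element and not on a proof;
      -- the default 0 arises only outside the range.
      code : C → ℕ
      code x with em {Range c x}
      ... | yes (i , _) = Fin.toℕ i
      ... | no  _       = 0
      code-injective : ∀ {x y} → Range c x → Range c y → code x ≡ code y → x ≡ y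
      code-injective {x} {y} x∈ y∈ eq with em {Range c x} | em {Range c y}
      ... | yes (i , refl) | yes (j , refl) = cong (lookup c) (toℕ-injective eq)
      ... | no x∉          | _              = contradiction x∈ x∉
      ... | _              | no y∉          = contradiction y∈ y∉

    saturated⇒overTuples : {L : Language ℓ} {M : Structure L} →
                           Saturated K M → SaturatedOverTuples M
    saturated⇒overTuples {M = M} saturated {n} c p fs =
      let x , h = saturated (Range c) (Range-small c) q (λ Δ Δ⊆q →
                    let Φ , Φ⊆p , hΦ = formulas Δ Δ⊆q ; x , hx = fs Φ Φ⊆p in x , hΦ x hx)
      in x , λ φ φ∈p → h (atTuple φ) (φ , φ∈p , refl)
      where
      atTuple : Formula _ (ℕ.suc n) → FormulaOver M (Range c) 1
      atTuple φ = record
        { formula = φ ; params = c ; params∈A = AllProps.lookup⁻ λ i → i , refl }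
      q : Pred (FormulaOver M (Range c) 1) ℓ
      q ψ = ∃ λ φ → p φ × ψ ≡ atTuple φ
      formulas : ∀ Δ → ListAll.All q Δ → ∃ λ Φ → ListAll.All p Φ ×
        (∀ x → ListAll.All (λ φ → M ⊨ φ [ x ∷ c ]) Φ → ListAll.All (λ ψ → Solutions M ψ (x ∷ [])) Δ)
      formulas []      []                       = [] , [] , λ _ _ → []
      formulas (_ ∷ Δ) ((φ , φ∈p , refl) ∷ Δ⊆q) =
        let Φ , Φ⊆p , h = formulas Δ Δ⊆q in
        φ ∷ Φ , φ∈p ∷ Φ⊆p , λ { x (y ∷ ys) → y ∷ h x ys }

  module _ {L : Language ℓ} {M : Structure L} {p : ℕ} (as : Vec (Carrier M) p) where

    open FormulaOver

    -- A formula over the range may use entries of `as` in any order and repeatedly. The positions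
    -- stored in the membership proofs rewrite it over the one fixed tuple.
    overRange : FormulaOver M (Range as) n → Formula L (n + p)
    overRange ψ = rename (allFin _ ⊕ All.reduce proj₁ (params∈A ψ)) (formula ψ)

    ⊨-overRange : (ψ : FormulaOver M (Range as) n) (xs : Vec (Carrier M) n) →
                  (M ⊨ overRange ψ [ xs ++ as ]) ⇔ Solutions M ψ xs
    ⊨-overRange ψ xs = ⊨-cong M (formula ψ)
      (trans (map-lookup-⊕ xs as (allFin _) (All.reduce proj₁ (params∈A ψ)))
             (cong₂ _++_ (map-lookup-allFin xs) (lookup-params (params∈A ψ))))
      ⇔-∘ ⊨-rename M _ (formula ψ) _
      where
      lookup-params : ∀ {n} {ps : Vec (Carrier M) n} (ps∈ : All (Range as) ps) →
                      map (lookup as) (All.reduce proj₁ ps∈) ≡ ps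
      lookup-params []               = refl
      lookup-params ((_ , eq) ∷ ps∈) = cong₂ _∷_ eq (lookup-params ps∈)

  -- Finitely homogeneous structures

  module Homogeneous {L₀ : Language ℓ} (I : Structure L₀) (FH : FinitelyHomogeneous I) where
    open FinitelyHomogeneous FH

    -- An element may occur in a at several positions; `True` of a decision leaves one membership
    -- proof, as substructures require.
    Listed : Vec (Carrier I) k → Pred (Carrier I) ℓ
    Listed a x = Lift ℓ (True (em {∃ λ i → lookup a i ≡ x}))

    position : (a : Vec (Carrier I) k) (x : ∃ (Listed a)) → ∃ λ i → lookup a i ≡ proj₁ x
    position a x = toWitness (lower (proj₂ x))

    entry : (a : Vec (Carrier I) k) → Fin k → ∃ (Listed a)
    entry a i = lookup a i , lift (fromWitness (i , refl))

    Listed-≡ : {a : Vec (Carrier I) k} {x y : ∃ (Listed a)} → proj₁ x ≡ proj₁ y → x ≡ y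
    Listed-≡ {x = x , lift p} {_ , lift q} refl = cong (λ p → x , lift p) (T-irrelevant p q)

    entry-cover : (a : Vec (Carrier I) k) (x : ∃ (Listed a)) → ∃ λ i → entry a i ≡ x
    entry-cover a x = let i , eq = position a x in i , Listed-≡ {a = a} eq

    -- The language is relational, so any nonempty set of entries is a substructure; the successor
    -- length keeps the universe nonempty.
    ⟨_⟩ : Vec (Carrier I) (ℕ.suc k) → Substructure I
    ⟨ a ⟩ = record
      { domain     = Listed a
      ; irrelevant = λ { (lift p) (lift q) → cong lift (T-irrelevant p q) }
      ; inhabited  = entry a Fin.zero
      ; closed     = λ f → contradiction f relational
      }

    ⟨_⟩ₛ : Vec (Carrier I) (ℕ.suc k) → Structure L₀
    ⟨ a ⟩ₛ = Substructure.structure ⟨ a ⟩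

    ⟨⟩-finite : (a : Vec (Carrier I) (ℕ.suc k)) → Finite (∃ (Listed a))
    ⟨⟩-finite a = finite-image (entry a) (entry-cover a)

    restrict : (a : Vec (Carrier I) (ℕ.suc k)) → Automorphism I → Embedding ⟨ a ⟩ₛ I
    restrict a g = record
      { to        = G.to ∘ proj₁
      ; injective = Listed-≡ {a = a} ∘ G.injective
      ; fun-pres  = λ f → contradiction f relational
      ; rel-pres  = λ R xs →
          ≡⇒⇔ (cong (relⁱ I R) (sym (map-∘ G.to proj₁ xs))) ⇔-∘ G.rel-pres R (map proj₁ xs)
      }
      where module G = Isomorphism g

    inclusion : (a : Vec (Carrier I) (ℕ.suc k)) → Embedding ⟨ a ⟩ₛ I
    inclusion a = record
      { to        = proj₁
      ; injective = Listed-≡ {a = a}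
      ; fun-pres  = λ f → contradiction f relational
      ; rel-pres  = λ R xs → ⇔-id _
      }

    ⟨⟩∈Age : (a : Vec (Carrier I) (ℕ.suc k)) → Age I ⟨ a ⟩ₛ
    ⟨⟩∈Age a = ⟨⟩-finite a , inclusion a

    -- Basic formulas, and the automorphisms obtained from agreement on them

    numRels : ℕ
    numRels = proj₁ finiteLanguage

    private module Enum = Inverse (proj₂ finiteLanguage)

    -- Relations get a dummy first variable, so that no basic formula is a
    -- sentence: a trace definition says nothing about arity zero.
    basicArity : Fin (ℕ.suc numRels) → ℕ
    basicArity Fin.zero    = 1
    basicArity (Fin.suc j) = relArity L₀ (Enum.from j)

    basic : ∀ j → Formula L₀ (ℕ.suc (basicArity j))
    basic Fin.zero    = var Fin.zero ≈ᶠ var (Fin.suc Fin.zero)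
    basic (Fin.suc j) = relᶠ (Enum.from j) (map var (map Fin.suc (allFin _)))

    -- Equality of quantifier-free types: σ runs through all ways of filling a basic formula with
    -- entries.
    BasicEquivalent : Vec (Carrier I) k → Vec (Carrier I) k → Set ℓ
    BasicEquivalent {k} a b = ∀ j (σ : Vec (Fin k) (ℕ.suc (basicArity j))) →
      (I ⊨ basic j [ map (lookup a) σ ]) ⇔ (I ⊨ basic j [ map (lookup b) σ ])

    -- Agreement on equations makes matching by position well defined and injective, and agreement
    -- on relations makes it an isomorphism. Homogeneity then extends it to I.
    module Agreement {a b : Vec (Carrier I) (ℕ.suc k)}
      (≡-agree : ∀ i j → (lookup a i ≡ lookup a j) ⇔ (lookup b i ≡ lookup b j))
      (rel-agree : ∀ R (σ : Vec (Fin (ℕ.suc k)) (relArity L₀ R)) →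
                   relⁱ I R (map (lookup a) σ) ⇔ relⁱ I R (map (lookup b) σ))
      where

      match : ∃ (Listed a) → ∃ (Listed b)
      match x = entry b (proj₁ (position a x))

      match-entry : ∀ i → proj₁ (match (entry a i)) ≡ lookup b i
      -- `position` may return another index j with the same entry of a; by agreement b has equal
      -- entries at j and i too.
      match-entry i = let j , eq = position a (entry a i) in to (≡-agree j i) eq

      isomorphism : Isomorphism ⟨ a ⟩ₛ ⟨ b ⟩ₛ
      isomorphism = record
        { embedding = record
          { to        = match
          ; injective = λ {x} {y} eq →
              let i , aᵢ≡x = position a x ; j , aⱼ≡y = position a y in
              Listed-≡ {a = a} (trans (sym aᵢ≡x) (trans (from (≡-agree i j) (cong proj₁ eq)) aⱼ≡y))
          ; fun-pres  = λ f → contradiction f relational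
          ; rel-pres  = λ R xs → let σ = map (proj₁ ∘ position a) xs in
              ≡⇒⇔ (cong (relⁱ I R) (trans (sym (map-∘ (lookup b) _ xs)) (map-∘ proj₁ match xs))) ⇔-∘
              (rel-agree R σ ⇔-∘
              ≡⇒⇔ (cong (relⁱ I R) (trans (map-cong (sym ∘ proj₂ ∘ position a) xs) (map-∘ (lookup a) _ xs))))
          }
        ; surjective = λ y → let i , bᵢ≡y = position b y in
            entry a i , λ { refl → Listed-≡ {a = b} (trans (match-entry i) bᵢ≡y) }
        }

      automorphism : ∃ λ (g : Automorphism I) → map (Isomorphism.to g) a ≡ b
      automorphism =
        let g , eq = homogeneous ⟨ a ⟩ ⟨ b ⟩ (⟨⟩-finite a) (⟨⟩-finite b) isomorphism in
        g , (begin
          map (Isomorphism.to g) a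
            ≡⟨ cong (map _) (tabulate∘lookup a) ⟨
          map (Isomorphism.to g) (Vec.tabulate (lookup a))
            ≡⟨ tabulate-∘ _ (lookup a) ⟨
          Vec.tabulate (Isomorphism.to g ∘ lookup a)
            ≡⟨ tabulate-cong (λ i → trans (eq (entry a i)) (match-entry i)) ⟩
          Vec.tabulate (lookup b)
            ≡⟨ tabulate∘lookup b ⟩
          b ∎)
        where open ≡-Reasoning

    ⊨-basic-rel : ∀ j x (xs : Vec (Carrier I) (relArity L₀ (Enum.from j))) →
                  (I ⊨ basic (Fin.suc j) [ x ∷ xs ]) ⇔ relⁱ I (Enum.from j) xs
    ⊨-basic-rel j x xs = ≡⇒⇔ (cong (relⁱ I (Enum.from j))
      (trans (evals-var I (x ∷ xs) (map Fin.suc (allFin _)))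
      (trans (sym (map-∘ _ Fin.suc (allFin _))) (map-lookup-allFin xs))))

    basic⇒automorphism : {a b : Vec (Carrier I) (ℕ.suc k)} → BasicEquivalent a b →
                         ∃ λ (g : Automorphism I) → map (Isomorphism.to g) a ≡ b
    basic⇒automorphism {k} {a} {b} ab =
      Agreement.automorphism (λ i j → ab Fin.zero (i ∷ j ∷ [])) λ R →
        subst (λ R → ∀ (σ : Vec (Fin (ℕ.suc k)) (relArity L₀ R)) →
                  relⁱ I R (map (lookup a) σ) ⇔ relⁱ I R (map (lookup b) σ))
          (Enum.strictlyInverseʳ R)
          λ σ → ⊨-basic-rel (Enum.to R) _ _ ⇔-∘
            -- The dummy first variable is filled with the entry at position zero, which exists as
            -- the tuple is nonempty.
            (ab (Fin.suc (Enum.to R)) (Fin.zero ∷ σ) ⇔-∘ ⇔-sym (⊨-basic-rel (Enum.to R) _ _))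

    automorphism⇒≋ : (g : Automorphism I) (a : Vec (Carrier I) k) → I ⊢ a ≋ map (Isomorphism.to g) a
    automorphism⇒≋ g a φ = ⊨-iso g φ a

    ≋⇒basic : {a b : Vec (Carrier I) k} → I ⊢ a ≋ b → BasicEquivalent a b
    ≋⇒basic a≋b j σ =
      ⊨-rename I σ (basic j) _ ⇔-∘ (a≋b (rename σ (basic j)) ⇔-∘ ⇔-sym (⊨-rename I σ (basic j) _))

    ≋⇒automorphism : {a b : Vec (Carrier I) (ℕ.suc k)} → I ⊢ a ≋ b →
                     ∃ λ (g : Automorphism I) → map (Isomorphism.to g) a ≡ b
    ≋⇒automorphism {a = a} {b} a≋b = basic⇒automorphism {a = a} {b} (≋⇒basic a≋b)

    -- Quantifier elimination for I in semantic form: the automorphism supplied by homogeneity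
    -- preserves every formula.
    basic⇒≋ : {a b : Vec (Carrier I) (ℕ.suc k)} → BasicEquivalent a b → I ⊢ a ≋ b
    basic⇒≋ {a = a} {b} ab with g , refl ← basic⇒automorphism {a = a} {b} ab =
      automorphism⇒≋ g a

    -- The Ramsey property yields embeddings of finite substructures, while composing with τ takes a
    -- map on all of I.
    embedding⇒automorphism : (b : Vec (Carrier I) (ℕ.suc k)) (ι : Embedding ⟨ b ⟩ₛ I) →
      ∃ λ (g : Automorphism I) → ∀ i → Isomorphism.to g (lookup b i) ≡ Embedding.to ι (entry b i)
    embedding⇒automorphism {k} b ι =
      let g , eq = Agreement.automorphism {a = b} {b′} ≡-agree rel-agree in
      g , λ i → trans (sym (lookup-map i (Isomorphism.to g) b))
                (trans (cong (λ v → lookup v i) eq) (lookup-b′ i))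
      where
      module ι = Embedding ι
      b′ = Vec.tabulate (ι.to ∘ entry b)
      lookup-b′ : ∀ i → lookup b′ i ≡ ι.to (entry b i)
      lookup-b′ = lookup∘tabulate (ι.to ∘ entry b)
      ≡-agree : ∀ i j → (lookup b i ≡ lookup b j) ⇔ (lookup b′ i ≡ lookup b′ j)
      ≡-agree i j =
        ≡⇒⇔ (cong₂ _≡_ (sym (lookup-b′ i)) (sym (lookup-b′ j))) ⇔-∘
        mk⇔ (cong ι.to ∘ Listed-≡ {a = b}) (cong proj₁ ∘ ι.injective)
      rel-agree : ∀ R (σ : Vec (Fin (ℕ.suc k)) (relArity L₀ R)) →
                  relⁱ I R (map (lookup b) σ) ⇔ relⁱ I R (map (lookup b′) σ)
      rel-agree R σ =
        ≡⇒⇔ (cong (relⁱ I R) (trans (sym (map-∘ ι.to (entry b) σ)) (map-cong (sym ∘ lookup-b′) σ))) ⇔-∘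
        (ι.rel-pres R (map (entry b) σ) ⇔-∘ ≡⇒⇔ (cong (relⁱ I R) (map-∘ proj₁ (entry b) σ)))

    -- The Ramsey property in terms of types

    colour : {P : Set ℓ} → Dec P → Fin 2
    colour (yes _) = Fin.zero
    colour (no  _) = Fin.suc Fin.zero

    colour-≡ : {P Q : Set ℓ} (P? : Dec P) (Q? : Dec Q) → colour P? ≡ colour Q? → P ⇔ Q
    colour-≡ (yes p) (yes q) _ = mk⇔ (λ _ → q) (λ _ → p)
    colour-≡ (no ¬p) (no ¬q) _ = mk⇔ (λ p → contradiction p ¬p) (λ q → contradiction q ¬q)

    _Within_ : Vec (Carrier I) k → Vec (Carrier I) n → Set ℓ
    xs Within b = ∀ i → ∃ λ j → lookup b j ≡ lookup xs i

    values : {z : Vec (Carrier I) (ℕ.suc k)} → Embedding ⟨ z ⟩ₛ I → Vec (Carrier I) (ℕ.suc k)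
    values {z = z} e = Vec.tabulate (Embedding.to e ∘ entry z)

    -- `Ramsey` colours embeddings, whereas types concern tuples. As z and the image of xs under g
    -- have the same type, some automorphism f takes one to the other, and f restricted to `⟨ z ⟩`
    -- is the embedding; it ranges in ι because g agrees with ι on b.
    copy : (z : Vec (Carrier I) (ℕ.suc k)) (b : Vec (Carrier I) (ℕ.suc n))
      (ι : Embedding ⟨ b ⟩ₛ I) (g : Automorphism I) →
      (∀ i → Isomorphism.to g (lookup b i) ≡ Embedding.to ι (entry b i)) →
      ∀ xs → I ⊢ z ≋ xs → xs Within b →
      ∃ λ (e : Embedding ⟨ z ⟩ₛ I) → values {z = z} e ≡ map (Isomorphism.to g) xs × e RangesIn ι
    copy z b ι g g≗ι xs z≋xs xs∈b =
      restrict z f ,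
      trans (tabulate-∘ F.to (lookup z)) (trans (cong (map F.to) (tabulate∘lookup z)) eq) ,
      λ x → let i , zᵢ≡x = position z x ; j , bⱼ≡xsᵢ = xs∈b i in entry b j , (begin
        F.to (proj₁ x)               ≡⟨ cong F.to zᵢ≡x ⟨
        F.to (lookup z i)            ≡⟨ lookup-map i F.to z ⟨
        lookup (map F.to z) i        ≡⟨ cong (λ v → lookup v i) eq ⟩
        lookup (map G.to xs) i       ≡⟨ lookup-map i G.to xs ⟩
        G.to (lookup xs i)           ≡⟨ cong G.to bⱼ≡xsᵢ ⟨
        G.to (lookup b j)            ≡⟨ g≗ι j ⟩
        Embedding.to ι (entry b j)   ∎)
      where
      module G = Isomorphism g
      moved : ∃ λ (f : Automorphism I) → map (Isomorphism.to f) z ≡ map G.to xs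
      moved = ≋⇒automorphism λ φ → automorphism⇒≋ g xs φ ⇔-∘ z≋xs φ
      f = proj₁ moved
      eq = proj₂ moved
      module F = Isomorphism f
      open ≡-Reasoning

    -- An embedding of `⟨ z ⟩` is coloured by whether P holds of its values. The monochromatic copy
    -- of b extends to g, and `copy` turns tuples within b into embeddings of the common colour.
    ramsey-automorphism : Ramsey I → (z : Vec (Carrier I) (ℕ.suc k))
      (P : Pred (Vec (Carrier I) (ℕ.suc k)) ℓ) (b : Vec (Carrier I) (ℕ.suc n)) →
      ∃ λ (g : Automorphism I) → ∀ xs ys →
        I ⊢ z ≋ xs → I ⊢ z ≋ ys → xs Within b → ys Within b →
        P (map (Isomorphism.to g) xs) ⇔ P (map (Isomorphism.to g) ys)
    ramsey-automorphism ramsey z P b =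
      let ι , monochromatic = ramsey ⟨ z ⟩ₛ ⟨ b ⟩ₛ (⟨⟩∈Age z) (⟨⟩∈Age b) 2
            (λ e → colour (em {P (values {z = z} e)}))
            (λ e e′ e≗e′ → cong (λ v → colour (em {P v})) (tabulate-cong (e≗e′ ∘ entry z)))
          g , g≗ι = embedding⇒automorphism b ι
      in g , λ xs ys z≋xs z≋ys xs∈b ys∈b →
        let e  , eq  , e⊆ι  = copy z b ι g g≗ι xs z≋xs xs∈b
            e′ , eq′ , e′⊆ι = copy z b ι g g≗ι ys z≋ys ys∈b
        in subst₂ (λ u v → P u ⇔ P v) eq eq′
             (colour-≡ (em {P (values {z = z} e)}) (em {P (values {z = z} e′)})
               (monochromatic e e′ e⊆ι e′⊆ι))

    -- The quantifier-free type decides the type and consists of finitely many tests, so I has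
    -- finitely many types of each positive length.
    ≋-representatives : (Q : Pred (Vec (Carrier I) (ℕ.suc k)) ℓ) →
      ∃ λ (reps : List (∃ Q)) → ∀ xs → Q xs → Any.Any (λ r → I ⊢ xs ≋ proj₁ r) reps
    ≋-representatives {k} Q =
      let reps , cover = representatives Q tests in
      reps , λ xs xs∈Q → Any.map
        (λ h → basic⇒≋ λ j σ → ListAll.lookup h
          (∈-concatMap⁺ testsFor (Any.map (λ { refl → ∈-map⁺ (test j) (∈-vectors σ) }) (∈-allFin j))))
        (cover xs xs∈Q)
      where
      test : ∀ j → Vec (Fin (ℕ.suc k)) (ℕ.suc (basicArity j)) → Pred (Vec (Carrier I) (ℕ.suc k)) ℓ
      test j σ xs = I ⊨ basic j [ map (lookup xs) σ ]
      testsFor : Fin (ℕ.suc numRels) → List (Pred (Vec (Carrier I) (ℕ.suc k)) ℓ)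
      testsFor j = List.map (test j) (vectors (ℕ.suc k) (ℕ.suc (basicArity j)))
      tests : List (Pred (Vec (Carrier I) (ℕ.suc k)) ℓ)
      tests = List.concatMap testsFor (List.allFin _)

    -- From pictures to trace definitions

    module _ {L : Language ℓ} (M : Structure L) {m : ℕ}
      (A : Pred (Carrier M) ℓ) (γ : Carrier I → Vec (Carrier M) m)
      (indiscernible : Indiscernible I M A γ) (uncollapsed : Uncollapsed I M A γ) where

      separate : (a b : Vec (Carrier I) (ℕ.suc k)) → ¬ (I ⊢ a ≋ b) →
        ∃ λ (φ : FormulaOver M A (ℕ.suc k * m)) →
          Solutions M φ (concat (map γ a)) × ¬ Solutions M φ (concat (map γ b))
      separate {k} a b a≢b with em {∃ λ (φ : FormulaOver M A (ℕ.suc k * m)) →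
          Solutions M φ (concat (map γ a)) × ¬ Solutions M φ (concat (map γ b))}
      ... | yes φ = φ
      ... | no ∄φ = contradiction (tp⇒≋ I (uncollapsed (ℕ.suc k) a b (
        (λ {φ} φ∈a → decidable-stable em λ φ∉b → ∄φ (φ , φ∈a , φ∉b)) ,
        -- A formula true at b but not at a separates the other way round; its complement serves.
        (λ {φ} φ∈b → decidable-stable em λ φ∉a →
          ∄φ (complement φ , (λ φ∈a → contradiction φ∈a φ∉a) , λ φ∉b → ⊥-elimₚ (φ∉b φ∈b))))))
        a≢b

      γ-invariant : {a b : Vec (Carrier I) (ℕ.suc k)} → I ⊢ a ≋ b → (φ : FormulaOver M A (ℕ.suc k * m)) →
        Solutions M φ (concat (map γ a)) ⇔ Solutions M φ (concat (map γ b))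
      γ-invariant {k} {a} {b} a≋b φ =
        let ⊆ , ⊇ = indiscernible (ℕ.suc k) a b (≋⇒tp I a≋b) in mk⇔ (⊆ {φ}) (⊇ {φ})

      -- A definable set of tuples is a union of finitely many types, and each
      -- of them is cut out by separating it from the finitely many others.
      traceFormula : (χ : Formula L₀ (ℕ.suc k)) → ∃ λ (φ : FormulaOver M A (ℕ.suc k * m)) →
        ∀ xs → (I ⊨ χ [ xs ]) ⇔ Solutions M φ (concat (map γ xs))
      traceFormula {k} χ = ⋃ (λ a → ⋂ (separator a) outside) inside ,
        λ xs → mk⇔
          (λ xs∈χ → from (Solutions-⋃ _ inside _) (Any.map
            (λ {a} xs≋a → from (Solutions-⋂ (separator a) outside _) (ListAll.universal
              (λ b → from (γ-invariant xs≋a (separator a b)) (proj₁ (proj₂ (separated a b)))) outside))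
            (inside-cover xs xs∈χ)))
          (λ h → decidable-stable em λ xs∉χ →
            let a , h′ = Any.satisfied (to (Solutions-⋃ _ inside _) h) in
            contradiction-at a (to (Solutions-⋂ (separator a) outside _) h′) (outside-cover xs xs∉χ))
        where
        inside-reps  = ≋-representatives {k} (λ xs → I ⊨ χ [ xs ])
        outside-reps = ≋-representatives {k} (λ xs → ¬ (I ⊨ χ [ xs ]))
        inside        = proj₁ inside-reps
        inside-cover  = proj₂ inside-reps
        outside       = proj₁ outside-reps
        outside-cover = proj₂ outside-reps
        separated : (a : ∃ λ xs → I ⊨ χ [ xs ]) (b : ∃ λ xs → ¬ (I ⊨ χ [ xs ])) → _
        separated (a , a∈χ) (b , b∉χ) = separate a b λ a≋b → b∉χ (to (a≋b χ) a∈χ)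
        separator : (∃ λ xs → I ⊨ χ [ xs ]) → (∃ λ xs → ¬ (I ⊨ χ [ xs ])) → FormulaOver M A (ℕ.suc k * m)
        separator a b = proj₁ (separated a b)
        contradiction-at : ∀ a {xs bs} →
          ListAll.All (λ b → Solutions M (separator a b) (concat (map γ xs))) bs →
          Any.Any (λ b → I ⊢ xs ≋ proj₁ b) bs → ⊥
        contradiction-at a (h ∷ _)  (here {b} xs≋b) =
          proj₂ (proj₂ (separated a b)) (to (γ-invariant xs≋b (separator a b)) h)
        contradiction-at a (_ ∷ hs) (there b∈) = contradiction-at a hs b∈

      -- `traceFormula` treats formulas without parameters, so the parameters c of X first count as
      -- further points and are then fixed at their images under γ.
      picture⇒trace : IsTraceDefinition I M γ
      picture⇒trace ℕ.zero X _ = contradiction refl (ℕ.≢-nonZero⁻¹ 0)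
      picture⇒trace (ℕ.suc k) X (record { formula = χ ; params = c } , X⊆ , ⊆X) =
        Solutions M ψ , (ψ , ≐-refl) , (λ {xs} → to (X⇔ψ xs)) , (λ {xs} → from (X⇔ψ xs))
        where
        traced = traceFormula χ
        φ = proj₁ traced
        ψ : FormulaOver M U (ℕ.suc k * m)
        ψ = substitute {k = ℕ.suc k} φ (map γ c)
        X⇔ψ : ∀ xs → X xs ⇔ Solutions M ψ (concat (map γ xs))
        X⇔ψ xs =
          ⇔-sym (Solutions-substitute {k = ℕ.suc k} φ (map γ c) (map γ xs)) ⇔-∘
          (≡⇒⇔ (cong (Solutions M φ ∘ concat) (map-++ γ xs c)) ⇔-∘
          (proj₂ traced (xs ++ c) ⇔-∘ mk⇔ X⊆ ⊆X))

    -- From trace definitions to pictures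

    module Assignments {L : Language ℓ} (m p : ℕ) .{{_ : NonZero m}}
      (θ : ∀ j → Formula L (ℕ.suc (basicArity j) * m + p)) where

      private module Index = Inverse countablyInfinite

      Assignment : Structure L → Set ℓ
      Assignment N = Vec (Carrier N) p × (Carrier I → Vec (Carrier N) m)

      -- `C` is the universe of a structure or else ℕ, for the numbers of the unknowns;
      -- `map-encodes` relates the two.
      environment : {c : Level} {C : Set c} → Vec C p × (Carrier I → Vec C m) →
                    Vec (Carrier I) n → Vec C (n * m + p)
      environment (as , τ) xs = concat (map τ xs) ++ as

      -- A type of I, represented by the tuple `shape`, with a formula whose truth value is to be
      -- made constant on that type.
      record Item : Set ℓ where
        constructor item
        field
          {pred}  : ℕ
          shape   : Vec (Carrier I) (ℕ.suc pred)
          formula : Formula L (ℕ.suc pred * m + p)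

      open Item

      data Constraint : Set ℓ where
        trace       : ∀ j → Vec (Carrier I) (ℕ.suc (basicArity j)) → Constraint
        homogeneity : ∀ t xs ys → I ⊢ shape t ≋ xs → I ⊢ shape t ≋ ys → Constraint

      Holds : (N : Structure L) → Assignment N → Constraint → Set ℓ
      Holds N α (trace j xs) = (I ⊨ basic j [ xs ]) ⇔ (N ⊨ θ j [ environment α xs ])
      Holds N α (homogeneity t xs ys _ _) =
        (N ⊨ formula t [ environment α xs ]) ⇔ (N ⊨ formula t [ environment α ys ])

      -- The numbers below p belong to the parameters. After subtraction of p, remainder and
      -- quotient by m give back coordinate and point.
      elemVar : Carrier I → Fin m → ℕ
      elemVar x c = p + (Fin.toℕ c + Index.to x * m)

      elemVars : Carrier I → Vec ℕ m
      elemVars x = Vec.tabulate (elemVar x)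

      paramVars : Vec ℕ p
      paramVars = Vec.tabulate Fin.toℕ

      elemVar-injective : ∀ {x y c d} → elemVar x c ≡ elemVar y d → x ≡ y × c ≡ d
      elemVar-injective {x} {y} {c} {d} eq =
        Injection.injective (↔⇒↣ countablyInfinite)
          (ℕ.*-cancelʳ-≡ (Index.to x) (Index.to y) m
            (ℕ.+-cancelˡ-≡ (Fin.toℕ c) _ _ (trans eq′ (cong (_+ _) (sym c≡d))))) ,
        toℕ-injective c≡d
        where
        eq′ : Fin.toℕ c + Index.to x * m ≡ Fin.toℕ d + Index.to y * m
        eq′ = ℕ.+-cancelˡ-≡ p _ _ eq
        c≡d : Fin.toℕ c ≡ Fin.toℕ d
        c≡d = begin
          Fin.toℕ c                             ≡⟨ m<n⇒m%n≡m (toℕ<n c) ⟨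
          Fin.toℕ c % m                         ≡⟨ [m+kn]%n≡m%n (Fin.toℕ c) (Index.to x) m ⟨
          (Fin.toℕ c + Index.to x * m) % m      ≡⟨ cong (_% m) eq′ ⟩
          (Fin.toℕ d + Index.to y * m) % m      ≡⟨ [m+kn]%n≡m%n (Fin.toℕ d) (Index.to y) m ⟩
          Fin.toℕ d % m                         ≡⟨ m<n⇒m%n≡m (toℕ<n d) ⟩
          Fin.toℕ d                             ∎
          where open ≡-Reasoning

      module _ (N : Structure L) where

        Encodes : (ℕ → Carrier N) → Assignment N → Set ℓ
        Encodes s (as , τ) = map s paramVars ≡ as × (∀ x → map s (elemVars x) ≡ τ x)

        encode : (α : Assignment N) → ∃ λ s → Encodes s α
        encode (as , τ) = s ,
          trans (sym (tabulate-∘ s Fin.toℕ)) (trans (tabulate-cong s-param) (tabulate∘lookup as)) ,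
          λ x → trans (sym (tabulate-∘ s (elemVar x)))
                (trans (tabulate-cong (s-elem x)) (tabulate∘lookup (τ x)))
          where
          s : ℕ → Carrier N
          -- A number is decoded by a search, whose outcome is unique by `elemVar-injective`;
          -- `nonempty N` is the default for a failed search.
          s v with v ℕ.<? p | em {∃₂ λ x c → elemVar x c ≡ v}
          ... | yes v<p | _                = lookup as (Fin.fromℕ< v<p)
          ... | no  _   | yes (x , c , _)  = lookup (τ x) c
          ... | no  _   | no  _            = nonempty N
          s-param : ∀ i → s (Fin.toℕ i) ≡ lookup as i
          s-param i with Fin.toℕ i ℕ.<? p
          ... | yes v<p = cong (lookup as) (fromℕ<-toℕ i v<p)
          ... | no  v≮p = contradiction (toℕ<n i) v≮p
          s-elem : ∀ x c → s (elemVar x c) ≡ lookup (τ x) c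
          s-elem x c with elemVar x c ℕ.<? p | em {∃₂ λ y d → elemVar y d ≡ elemVar x c}
          ... | yes v<p | _                = contradiction (ℕ.m≤m+n p _) (ℕ.<⇒≱ v<p)
          ... | no  _   | no  ∄            = contradiction (x , c , refl) ∄
          ... | no  _   | yes (y , d , eq) with refl , refl ← elemVar-injective {y} {x} {d} {c} eq = refl

        map-encodes : ∀ {s α} → Encodes s α → (xs : Vec (Carrier I) n) →
                      map s (environment (paramVars , elemVars) xs) ≡ environment α xs
        map-encodes {s = s} {as , τ} (as-eq , τ-eq) xs =
          trans (map-++ s (concat (map elemVars xs)) paramVars) (cong₂ _++_
            (trans (map-concat s (map elemVars xs))
                   (cong concat (trans (sym (map-∘ _ _ xs)) (map-cong τ-eq xs))))
            as-eq)

      -- Whether a basic formula holds in I is a fixed fact, not a formula of L; requiring φ to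
      -- agree with it means requiring φ or its negation.
      signed : {P : Set ℓ} → Dec P → Formula L n → Formula L n
      signed (yes _) φ = φ
      signed (no  _) φ = ¬ᶠ φ

      ⊨-signed : (N : Structure L) {P : Set ℓ} (P? : Dec P) (φ : Formula L n) (xs : Vec (Carrier N) n) →
                 (N ⊨ signed P? φ [ xs ]) ⇔ (P ⇔ (N ⊨ φ [ xs ]))
      ⊨-signed N (yes a) φ xs = mk⇔ (λ h → mk⇔ (λ _ → h) (λ _ → a)) (λ e → to e a)
      ⊨-signed N (no ¬a) φ xs = mk⇔ (λ h → mk⇔ (λ a → contradiction a ¬a) (λ x → ⊥-elimₚ (h x)))
                                    (λ e x → contradiction (from e x) ¬a)

      instance-of : Constraint → Instance {L = L}
      instance-of (trace j xs) =
        signed (em {I ⊨ basic j [ xs ]}) (θ j) at environment (paramVars , elemVars) xs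
      instance-of (homogeneity (item {k} _ φ) xs ys _ _) =
        rename left φ ⇔ᶠ rename right φ at (vars xs ++ vars ys)
        where
        vars : Vec (Carrier I) (ℕ.suc k) → Vec ℕ _
        vars = environment (paramVars , elemVars)
        left right : Vec (Fin ((ℕ.suc k * m + p) + (ℕ.suc k * m + p))) (ℕ.suc k * m + p)
        left  = map (_↑ˡ _) (allFin _)
        right = map ((ℕ.suc k * m + p) ↑ʳ_) (allFin _)

      ⊩-instance : (N : Structure L) → ∀ {s α} → Encodes N s α → ∀ γ →
                   (N , s ⊩ instance-of γ) ⇔ Holds N α γ
      ⊩-instance N enc (trace j xs) =
        ⊨-signed N em (θ j) _ ⇔-∘ ⊨-cong N (signed em (θ j)) (map-encodes N enc xs)
      ⊩-instance N {s} {α} enc (homogeneity (item {k} _ φ) xs ys _ _) = ⇔-cong-⇔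
        (⊨-cong N φ leftEq ⇔-∘ ⊨-rename N (map (_↑ˡ _) (allFin _)) φ _)
        (⊨-cong N φ rightEq ⇔-∘ ⊨-rename N (map ((ℕ.suc k * m + p) ↑ʳ_) (allFin _)) φ _)
        where
        vs ws : Vec ℕ (ℕ.suc k * m + p)
        vs = environment (paramVars , elemVars) xs
        ws = environment (paramVars , elemVars) ys
        leftEq : map (lookup (map s (vs ++ ws))) (map (_↑ˡ _) (allFin _)) ≡ environment α xs
        leftEq rewrite map-++ s vs ws =
          trans (map-lookup-↑ˡ (map s vs) (map s ws)) (map-encodes N enc xs)
        rightEq : map (lookup (map s (vs ++ ws))) (map ((ℕ.suc k * m + p) ↑ʳ_) (allFin _)) ≡ environment α ys
        rightEq rewrite map-++ s vs ws =
          trans (map-lookup-↑ʳ (map s vs) (map s ws)) (map-encodes N enc ys)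

      -- Making an assignment homogeneous

      module _ {M : Structure L} (saturated : SaturatedOverTuples M) where

        -- N supplies solutions of the finite parts: first the model with the given trace
        -- definition, afterwards M itself.
        assignment-compactness :
          {N : Structure L} → ((φ : Sentence L) → N ⊨ φ [ [] ] → M ⊨ φ [ [] ]) →
          (Γ : Pred Constraint ℓ) →
          (∀ Δ → ListAll.All Γ Δ → ∃ λ α → ListAll.All (Holds N α) Δ) →
          ∃ λ α → ∀ γ → Γ γ → Holds M α γ
        assignment-compactness {N} N⇒M Γ satisfiable =
          let s , h = compactness in
          (map s paramVars , λ x → map s (elemVars x)) ,
          λ γ γ∈Γ → to (⊩-instance M (refl , λ _ → refl) γ) (h γ γ∈Γ)
          where
          encoded : ∀ Δ → ListAll.All Γ Δ → ∃ λ s → ListAll.All (λ γ → N , s ⊩ instance-of γ) Δ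
          encoded Δ Δ⊆Γ =
            let α , hα = satisfiable Δ Δ⊆Γ ; s , enc = encode N α in
            s , ListAll.map (λ {γ} → from (⊩-instance N enc γ)) hα
          open Compactness N⇒M saturated instance-of Γ encoded

        TracesAnd : List Item → Pred Constraint ℓ
        TracesAnd ts (trace _ _)             = ⊤
        TracesAnd ts (homogeneity t _ _ _ _) = t ∈ ts

        module _ (ramsey : Ramsey I) where

          points : Constraint → List (Carrier I)
          -- Traces survive composition with any automorphism, so they contribute no points.
          points (trace _ _)               = []
          points (homogeneity _ xs ys _ _) = Vec.toList xs List.++ Vec.toList ys

          homogenise : ∀ t ts →
            (∃ λ α → ∀ γ → TracesAnd ts γ → Holds M α γ) →
            (∃ λ α → ∀ γ → TracesAnd (t ∷ ts) γ → Holds M α γ)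
          homogenise t ts (α@(as , τ) , h) =
            assignment-compactness (λ _ h → h) (TracesAnd (t ∷ ts)) finitely
            where
            module _ (Δ : List Constraint) (Δ⊆ : ListAll.All (TracesAnd (t ∷ ts)) Δ) where
              allPoints : List (Carrier I)
              -- The added point makes the tuple nonempty, as `ramsey-automorphism` demands.
              allPoints = nonempty I ∷ List.concatMap points Δ
              P : Pred (Vec (Carrier I) _) ℓ
              P xs = M ⊨ formula t [ environment α xs ]
              moved = ramsey-automorphism ramsey (shape t) P (Vec.fromList allPoints)
              g = proj₁ moved
              module G = Isomorphism g
              β : Assignment M
              β = as , τ ∘ G.to
              environment-β : (xs : Vec (Carrier I) n) → environment β xs ≡ environment α (map G.to xs)
              environment-β xs = cong (λ v → concat v ++ as) (map-∘ τ G.to xs)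
              ∈Δ⇒within : ∀ {γ} → γ ∈ Δ → ∀ {x} → x ∈ points γ →
                          ∃ λ j → lookup (Vec.fromList allPoints) j ≡ x
              ∈Δ⇒within γ∈Δ x∈γ =
                ∈⇒lookup-fromList (there (∈-concatMap⁺ points (Any.map (λ { refl → x∈γ }) γ∈Δ)))
              holds : ∀ γ → γ ∈ Δ → TracesAnd (t ∷ ts) γ → Holds M β γ
              holds (trace j xs) _ _ =
                ⊨-cong M (θ j) (sym (environment-β xs)) ⇔-∘
                (h (trace j (map G.to xs)) _ ⇔-∘ automorphism⇒≋ g xs (basic j))
              -- Moving by g keeps both tuples in the type of t′, where α is already homogeneous.
              holds (homogeneity t′ xs ys t≋xs t≋ys) _ (there t′∈ts) =
                ⊨-cong M (formula t′) (sym (environment-β ys)) ⇔-∘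
                (h (homogeneity t′ (map G.to xs) (map G.to ys)
                     (λ φ → automorphism⇒≋ g xs φ ⇔-∘ t≋xs φ)
                     (λ φ → automorphism⇒≋ g ys φ ⇔-∘ t≋ys φ)) t′∈ts ⇔-∘
                ⊨-cong M (formula t′) (environment-β xs))
              holds (homogeneity _ xs ys t≋xs t≋ys) γ∈Δ (here refl) =
                ⊨-cong M (formula t) (sym (environment-β ys)) ⇔-∘
                (proj₂ moved xs ys t≋xs t≋ys
                  (λ i → ∈Δ⇒within γ∈Δ (∈-++⁺ˡ (∈-toList⁺ (∈-lookup i xs))))
                  (λ i → ∈Δ⇒within γ∈Δ (∈-++⁺ʳ (Vec.toList xs) (∈-toList⁺ (∈-lookup i ys)))) ⇔-∘
                ⊨-cong M (formula t) (environment-β xs))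
              finitely : ∃ λ α → ListAll.All (Holds M α) Δ
              finitely = β , ListAll.tabulate λ {γ} γ∈Δ → holds γ γ∈Δ (ListAll.lookup Δ⊆ γ∈Δ)

          module _ {N : Structure L} (N⇒M : (φ : Sentence L) → N ⊨ φ [ [] ] → M ⊨ φ [ [] ])
            (α : Assignment N) (traced : ∀ j xs → Holds N α (trace j xs)) where

            homogeneous-for : ∀ ts → ∃ λ β → ∀ γ → TracesAnd ts γ → Holds M β γ
            homogeneous-for []       =
              -- The one passage from N to M: α meets all trace constraints in N, and every later
              -- application stays in M.
              assignment-compactness N⇒M (TracesAnd []) λ Δ Δ⊆ →
                α , ListAll.map (λ { {trace j xs} _ → traced j xs ; {homogeneity _ _ _ _ _} () }) Δ⊆
            homogeneous-for (t ∷ ts) = homogenise t ts (homogeneous-for ts)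

            -- A finite set of constraints mentions finitely many items, and `homogeneous-for`
            -- handles those; compactness then treats all items at once.
            fully-homogeneous : ∃ λ β → ∀ γ → Holds M β γ
            fully-homogeneous =
              let β , h = assignment-compactness (λ _ h → h) (λ _ → ⊤) λ Δ _ →
                    let β , h = homogeneous-for (items Δ) in
                    β , ListAll.tabulate λ {γ} γ∈Δ → h γ (γ∈items γ∈Δ)
              in β , λ γ → h γ _
              where
              items : List Constraint → List Item
              items []                          = []
              items (trace _ _ ∷ Δ)             = items Δ
              items (homogeneity t _ _ _ _ ∷ Δ) = t ∷ items Δ
              weaken : ∀ {t ts} γ → TracesAnd ts γ → TracesAnd (t ∷ ts) γ
              weaken (trace _ _)             _  = _
              weaken (homogeneity _ _ _ _ _) t∈ = there t∈
              γ∈items : ∀ {γ Δ} → γ ∈ Δ → TracesAnd (items Δ) γ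
              γ∈items {trace _ _}                     (here refl) = _
              γ∈items {homogeneity _ _ _ _ _}         (here refl) = here refl
              γ∈items {γ} {trace _ _ ∷ Δ}             (there γ∈)  = γ∈items γ∈
              γ∈items {γ} {homogeneity _ _ _ _ _ ∷ Δ} (there γ∈)  = weaken γ (γ∈items γ∈)

      -- The picture given by a homogeneous assignment

      module _ (M : Structure L) (as : Vec (Carrier M) p) (τ : Carrier I → Vec (Carrier M) m)
        (holds : ∀ γ → Holds M (as , τ) γ) where

        homogeneous⇒indiscernible : Indiscernible I M (Range as) τ
        homogeneous⇒indiscernible ℕ.zero    xs ys _     = contradiction refl (ℕ.≢-nonZero⁻¹ 0)
        homogeneous⇒indiscernible (ℕ.suc k) xs ys xs≐ys =
          (λ {ψ} → to (equivalent ψ)) , (λ {ψ} → from (equivalent ψ))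
          where
          equivalent : ∀ ψ → Solutions M ψ (concat (map τ xs)) ⇔ Solutions M ψ (concat (map τ ys))
          equivalent ψ = ⊨-overRange as ψ (concat (map τ ys)) ⇔-∘
            -- The tuple xs represents its own type.
            (holds (homogeneity (item xs (overRange as ψ)) xs ys (λ _ → ⇔-id _) (tp⇒≋ I xs≐ys)) ⇔-∘
            ⇔-sym (⊨-overRange as ψ (concat (map τ xs))))

        traced : ∀ k (xs : Vec (Carrier I) k) j (σ : Vec (Fin k) (ℕ.suc (basicArity j))) →
          (M ⊨ rename (selectBlocks m σ ⊕ allFin p) (θ j) [ concat (map τ xs) ++ as ]) ⇔
          (I ⊨ basic j [ map (lookup xs) σ ])
        traced k xs j σ = ⇔-sym (holds (trace j (map (lookup xs) σ))) ⇔-∘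
          (⊨-cong M (θ j) eq ⇔-∘ ⊨-rename M (selectBlocks m σ ⊕ allFin p) (θ j) _)
          where
          eq : map (lookup (concat (map τ xs) ++ as)) (selectBlocks m σ ⊕ allFin p) ≡
               environment (as , τ) (map (lookup xs) σ)
          eq = trans (map-lookup-⊕ (concat (map τ xs)) as (selectBlocks m σ) (allFin p)) (cong₂ _++_
            (trans (map-lookup-selectBlocks (map τ xs) σ) (cong concat (map-lookup-map τ xs σ)))
            (map-lookup-allFin as))

        -- Each quantifier-free test is traced by θ on the selected blocks, so it can be read off
        -- the type over `as`; by `basic⇒≋` these tests determine the type in I.
        traced⇒uncollapsed : Uncollapsed I M (Range as) τ
        traced⇒uncollapsed ℕ.zero    xs ys _       = contradiction refl (ℕ.≢-nonZero⁻¹ 0)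
        traced⇒uncollapsed (ℕ.suc k) xs ys (⊆ , ⊇) = ≋⇒tp I (basic⇒≋ λ j σ →
          let φ : FormulaOver M (Range as) (ℕ.suc k * m)
              φ = record { formula  = rename (selectBlocks m σ ⊕ allFin p) (θ j)
                         ; params   = as
                         ; params∈A = AllProps.lookup⁻ λ i → i , refl }
          in traced _ ys j σ ⇔-∘ (mk⇔ (⊆ {φ}) (⊇ {φ}) ⇔-∘ ⇔-sym (traced _ xs j σ)))

      module _ {K : Set ℓ} {M N : Structure L} (large : setoid (Fun L ⊎ Rel L ⊎ ℕ) ≺ setoid K)
        (saturated : Saturated K M) (N⇒M : (φ : Sentence L) → N ⊨ φ [ [] ] → M ⊨ φ [ [] ]) where

        assignment⇒picture : Ramsey I → (α : Assignment N) → (∀ j xs → Holds N α (trace j xs)) →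
                             HasSmallPicture I K M m
        assignment⇒picture ramsey α traces =
          let (as , τ) , holds = fully-homogeneous (saturated⇒overTuples large saturated) ramsey N⇒M α traces
          in τ , Range as , Range-small large as ,
             homogeneous⇒indiscernible M as τ holds , traced⇒uncollapsed M as τ holds

    trace⇒picture : Ramsey I → {L : Language ℓ} {T : Theory L} → Complete T →
      {K : Set ℓ} {M N : Structure L} → IsModel T M → HighlySaturated K M → IsModel T N →
      ∀ m .{{_ : NonZero m}} → HasTraceDefinition I N m → HasSmallPicture I K M m
    trace⇒picture ramsey complete {K} {M} {N} M⊨T (large , saturated , _) N⊨T m (τ , isTrace) =
      let p , as , θ = commonParameters (proj₁ ∘ basicTrace) in
      Assignments.assignment⇒picture m p (proj₁ ∘ θ) large saturated N⇒M ramsey (as , τ)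
        λ j xs → proj₂ (θ j) (concat (map τ xs)) ⇔-∘ proj₂ (basicTrace j) xs
      where
      N⇒M : ∀ φ → N ⊨ φ [ [] ] → M ⊨ φ [ [] ]
      -- Completeness makes any two models of T agree: were the negation of φ entailed, φ would fail
      -- in N.
      N⇒M φ h with complete φ
      ... | inj₁ T⊢φ  = T⊢φ M M⊨T
      ... | inj₂ T⊢¬φ = ⊥-elimₚ (T⊢¬φ N N⊨T h)
      basicTrace : ∀ j → ∃ λ (ψ : FormulaOver N U (ℕ.suc (basicArity j) * m)) →
        ∀ xs → (I ⊨ basic j [ xs ]) ⇔ Solutions N ψ (concat (map τ xs))
      basicTrace j =
        let Y , (ψ , Y⊆ψ , ψ⊆Y) , X⊆Y , Y⊆X = isTrace (ℕ.suc (basicArity j)) (λ xs → I ⊨ basic j [ xs ])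
              (parameterFree I (basic j) ,
                (λ {xs} → from (Solutions-parameterFree I {U} (basic j) xs)) ,
                (λ {xs} → to (Solutions-parameterFree I {U} (basic j) xs)))
        in ψ , λ xs → mk⇔ (Y⊆ψ ∘ X⊆Y) (Y⊆X ∘ ψ⊆Y)

proposition2p8 : {ℓ : Level} → ExcludedMiddle (suc ℓ) →
    (L₀ : Language ℓ) (I : Structure L₀) → FinitelyHomogeneous I → Ramsey I →
    (L : Language ℓ) (T : Theory L) → Complete T → Consistent T →
    (K : Set ℓ) (M : Structure L) → IsModel T M → HighlySaturated K M →
    ((m : ℕ) → .{{_ : NonZero m}} →
    HasTraceDefinition I M m ⇔ HasSmallPicture I K M m)
    ×
    (TraceDefines I T ⇔
    (∃ λ (m : ℕ) → NonZero m × HasSmallPicture I K M m))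
proposition2p8 EM L₀ I FH ramsey L T complete _ K M M⊨T high =
  (λ m → mk⇔ (forth M⊨T m) (back m)) ,
  -- The trace definition may live in a model N other than M; `forth` takes any model of T.
  mk⇔ (λ (N , m , N⊨T , m≢0 , t) → m , m≢0 , forth N⊨T m {{m≢0}} t)
      (λ (m , m≢0 , picture) → M , m , M⊨T , m≢0 , back m picture)
  where
  open Classical.Homogeneous EM I FH
  forth : {N : Structure L} → IsModel T N → ∀ m .{{_ : NonZero m}} →
          HasTraceDefinition I N m → HasSmallPicture I K M m
  forth = trace⇒picture ramsey complete M⊨T high
  back : ∀ m → HasSmallPicture I K M m → HasTraceDefinition I M m
  back m (γ , A , _ , indiscernible , uncollapsed) =
    γ , picture⇒trace M A γ indiscernible uncollapsed
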